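{- Let $k$ be a positive integer and $n\geqslant 0$ an integer. Then $$(-1)^{k-1}\left(\sum_{j=-(k-1)}^{k}(-1)^j\,\sigma\,\mathrm{mex}\big(n-j(3j-1)/2\big)-\delta(n)\right)=\sum_{j=0}^{\infty}M_k\big(n-j(j+1)/2\big).$$
   Context: For a partition $\lambda$, $\mathrm{mex}(\lambda)$ (the minimal excludant) is the smallest positive integer that is not a part of $\lambda$ (so the empty partition has mex $1$). For an integer $m\geqslant 0$, $\sigma\,\mathrm{mex}(m)=\sum_{\lambda}\mathrm{mex}(\lambda)$, the sum over all partitions $\lambda$ of $m$; $\sigma\,\mathrm{mex}(m)=0$ for $m<0$. $\delta(n)=1$ if $n=m(m+1)/2$ for some integer $m$, and $\delta(n)=0$ otherwise. For a positive integer $k$, $M_k(m)$ is the number of partitions of $m$ in which $k$ is the least positive integer that is not a part and there are more parts $>k$ than there are parts $<k$; $M_k(m)=0$ for $m<0$. -}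

module Defs where

open import Data.Nat as ℕ using (ℕ; zero; suc; _≤ᵇ_; _<ᵇ_)
open import Data.Integer as ℤ using (ℤ; +_; -[1+_]; _-_)
open import Data.List using (List; []; _∷_; map; concatMap; length; filterᵇ; upTo; foldr)
open import Data.Nat.ListAction using (sum)
open import Data.Bool using (Bool; true; false; if_then_else_; _∧_; not)

-- A partition is a weakly decreasing list of positive integers.
-- partsLE b m : all partitions of m with every part ≤ b (as weakly
-- decreasing lists of positive parts).  Fuel m+1 is structural.
partsLE : ℕ → ℕ → List (List ℕ)
partsLE b m = go (suc m) b m
  where
  go : ℕ → ℕ → ℕ → List (List ℕ)
  go fuel b zero = [] ∷ []
  go zero b (suc m) = []
  go (suc fuel) b (suc m) =
    concatMap (λ p → map (λ λs → p ∷ λs) (go fuel p (suc m ℕ.∸ p)))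
              (filterᵇ (λ p → p ≤ᵇ suc m) (Data.List.map suc (upTo b)))

partitions : ℕ → List (List ℕ)
partitions m = partsLE m m

elemᵇ : ℕ → List ℕ → Bool
elemᵇ x [] = false
elemᵇ x (y ∷ ys) = if x ℕ.≡ᵇ y then true else elemᵇ x ys

-- mex: smallest positive integer not a part (search up to length+1 suffices)
mexFrom : ℕ → ℕ → List ℕ → ℕ
mexFrom zero i λs = i
mexFrom (suc f) i λs = if elemᵇ i λs then mexFrom f (suc i) λs else i

mex : List ℕ → ℕ
mex λs = mexFrom (suc (length λs)) 1 λs

σmexℕ : ℕ → ℕ
σmexℕ m = sum (map mex (partitions m))

σmex : ℤ → ℤ
σmex (+ m) = + σmexℕ m
σmex -[1+ m ] = + 0

δ : ℕ → ℕ
δ n = if foldr (λ m b → (ℕ._≡ᵇ_ (m ℕ.* suc m) (2 ℕ.* n)) Data.Bool.∨ b) false (upTo (suc n))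
      then 1 else 0

countᵇ : (ℕ → Bool) → List ℕ → ℕ
countᵇ P xs = length (filterᵇ P xs)

Mℕ : ℕ → ℕ → ℕ
Mℕ k m = length (filterᵇ
  (λ λs → (mex λs ℕ.≡ᵇ k) ∧ (countᵇ (λ x → x <ᵇ k) λs <ᵇ countᵇ (λ x → k <ᵇ x) λs))
  (partitions m))

M : ℕ → ℤ → ℤ
M k (+ m) = + Mℕ k m
M k -[1+ m ] = + 0

Σℤ : ℤ → ℕ → (ℤ → ℤ) → ℤ
Σℤ a zero f = + 0
Σℤ a (suc l) f = f a ℤ.+ Σℤ (a ℤ.+ + 1) l f

Σℕ : ℕ → (ℕ → ℤ) → ℤ
Σℕ zero f = + 0
Σℕ (suc N) f = Σℕ N f ℤ.+ f N

sgn : ℤ → ℤ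
sgn j = if ℕ._≡ᵇ_ (ℕ._%_ ℤ.∣ j ∣ 2) 0 then + 1 else ℤ.- (+ 1)

-- j(3j-1)/2 for integer j (always a nonnegative integer)
pent : ℤ → ℤ
pent j = + (ℕ._/_ ℤ.∣ j ℤ.* (+ 3 ℤ.* j - + 1) ∣ 2)

{-# OPTIONS --safe #-}
module Submission where

-- Write p(n) for the number of partitions and T_j = j(j+1)/2.  Since mex λ is the
-- number of j ≥ 0 such that λ contains 1, …, j, and removing one copy of each of these
-- parts is a bijection, σmex(n) = Σ_j p(n − T_j).  So the theorem is the Andrews–Merca
-- truncated pentagonal number theorem summed over the shifts by T_j, and that one
-- follows by induction on k (starting from M_0 := 1) from
--   M_k + M_{k+1} = q^{k(3k+1)/2} (1 − q^{2k+1}) Σ p(n) q^n.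
-- With N parts exceeding k, M_k = q^{T_{k−1}} Σ_N q^{(k+1)N}/(q)_N [N−1, k−1]; the relation
-- comes from the q-Pascal rule, from splitting off the parts equal to k+1, and from
--   Σ_N q^{(k+1)N}/(q)_N [N, k] = q^{k(k+1)} Σ p(n) q^n.
-- Power series are coefficient sequences, and only shifts (multiplication by q^a)
-- and solutions g of g_t = F_t + q^{a+1} g_{t+1} are needed, never a product.

open import Defs
open import Data.Nat using (ℕ; zero; suc; _*_; _/_; _≤_; _<_; s≤s; z≤n; _∸_; _≤ᵇ_; _<ᵇ_; _≡ᵇ_; _≤′_; ≤′-refl; ≤′-step)
import Data.Nat as ℕ
open import Data.Nat.DivMod using (m*n/n≡m; [m+n]%n≡m%n)
open import Data.Nat.ListAction using (sum)
import Data.Nat.Properties as ℕₚ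
import Data.Nat.Tactic.RingSolver as ℕ-Ring
open import Data.Integer using (ℤ; +_; -[1+_]; -_; _-_; _+_; 0ℤ; 1ℤ)
import Data.Integer as ℤ
import Data.Integer.Properties as ℤₚ
open import Data.Integer.Tactic.RingSolver using (solve-∀)
open import Data.Bool using (Bool; true; false; if_then_else_; _∧_; _∨_; not; T)
open import Data.Bool.Properties using (∧-zeroʳ; ∧-identityʳ; ∨-identityʳ)
open import Data.Fin using (Fin; toℕ)
import Data.Fin.Properties as Finₚ
open import Data.List using (List; []; _∷_; _++_; map; concatMap; filterᵇ; foldr; length; lookup; upTo)
import Data.List.Properties as Listₚ
open import Data.List.Relation.Unary.All as All using (All; []; _∷_)
open import Data.List.Relation.Unary.Any as Any using (Any; here; there)
import Data.List.Relation.Unary.Any.Properties as Anyₚ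
open import Data.Product using (Σ-syntax; _×_; _,_; proj₁)
open import Data.Unit using (tt)
open import Relation.Binary.Definitions using (tri<; tri≈; tri>)
open import Relation.Binary.PropositionalEquality
open import Relation.Nullary using (¬_; yes; no; contradiction)
open import Relation.Nullary.Decidable using (dec-true; dec-false; T?)
open ≡-Reasoning

+-congˡ : ∀ x {y z} → y ≡ z → x + y ≡ x + z
+-congˡ x refl = refl

interchange : ∀ w x y z → (w + x) + (y + z) ≡ (w + y) + (x + z)
interchange = solve-∀

-- Power series as coefficient sequences, and shifts

Seq : Set
Seq = ℕ → ℤ

Family : Set
Family = ℕ → Seq

infix 4 _≈_ _≋_

_≈_ : Seq → Seq → Set
f ≈ g = ∀ m → f m ≡ g m

_≋_ : Family → Family → Set
F ≋ G = ∀ t → F t ≈ G t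

infixl 6 _⊕_
_⊕_ : Seq → Seq → Seq
(f ⊕ g) m = f m + g m

shift : ℕ → Seq → Seq
shift zero    f m       = f m
shift (suc a) f zero    = 0ℤ
shift (suc a) f (suc m) = shift a f m

-- Only the index `j` with `a + j = m` is read, so agreement is asked for there alone. The
-- inductions on the degree below rest on this.
shift-cong-at : ∀ a {f g} m → (∀ j → a ℕ.+ j ≡ m → f j ≡ g j) → shift a f m ≡ shift a g m
shift-cong-at zero    m       eq = eq m refl
shift-cong-at (suc a) zero    eq = refl
shift-cong-at (suc a) (suc m) eq = shift-cong-at a m (λ j p → eq j (cong suc p))

shift-cong : ∀ a {f g} → f ≈ g → shift a f ≈ shift a g
shift-cong a eq m = shift-cong-at a m (λ j _ → eq j)

shift-cong-≤ : ∀ a {f g} m → (∀ j → j ≤ m → f j ≡ g j) → shift a f m ≡ shift a g m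
shift-cong-≤ a m eq = shift-cong-at a m (λ j p → eq j (subst (j ≤_) p (ℕₚ.m≤n+m j a)))

shift-cong-< : ∀ a {f g} m → (∀ j → j < m → f j ≡ g j) → shift (suc a) f m ≡ shift (suc a) g m
shift-cong-< a m eq = shift-cong-at (suc a) m (λ j p → eq j (subst (j <_) p (s≤s (ℕₚ.m≤n+m j a))))

shift-⊕ : ∀ a f g → shift a (f ⊕ g) ≈ shift a f ⊕ shift a g
shift-⊕ zero    f g m       = refl
shift-⊕ (suc a) f g zero    = refl
shift-⊕ (suc a) f g (suc m) = shift-⊕ a f g m

shift-0 : ∀ a → shift a (λ _ → 0ℤ) ≈ λ _ → 0ℤ
shift-0 zero    m       = refl
shift-0 (suc a) zero    = refl
shift-0 (suc a) (suc m) = shift-0 a m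

shift-shift : ∀ a b f → shift a (shift b f) ≈ shift (a ℕ.+ b) f
shift-shift zero    b f m       = refl
shift-shift (suc a) b f zero    = refl
shift-shift (suc a) b f (suc m) = shift-shift a b f m

shift-comm : ∀ a b f → shift a (shift b f) ≈ shift b (shift a f)
shift-comm a b f m = begin
  shift a (shift b f) m  ≡⟨ shift-shift a b f m ⟩
  shift (a ℕ.+ b) f m    ≡⟨ cong (λ c → shift c f m) (ℕₚ.+-comm a b) ⟩
  shift (b ℕ.+ a) f m    ≡⟨ shift-shift b a f m ⟨
  shift b (shift a f) m  ∎

shift-> : ∀ a f m → m < a → shift a f m ≡ 0ℤ
shift-> (suc a) f zero    _         = refl
shift-> (suc a) f (suc m) (s≤s m<a) = shift-> a f m m<a

shift-if : ∀ a f m → shift a f m ≡ (if a ≤ᵇ m then f (m ∸ a) else 0ℤ)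
shift-if zero          f m       = refl
shift-if (suc a)       f zero    = refl
shift-if (suc zero)    f (suc m) = refl
shift-if (suc (suc a)) f (suc m) = shift-if (suc a) f m

-- Linear recurrences in the offset, and adjoining parts

IsSol : ℕ → Family → Family → Set
IsSol a F g = ∀ t m → g t m ≡ F t m + shift (suc a) (g (suc t)) m

-- The shift is by at least one, so the coefficient at `m` depends only on lower degrees of the next
-- term: strong induction on the degree, for all offsets at once.
IsSol-unique : ∀ a {F g h} → IsSol a F g → IsSol a F h → g ≋ h
IsSol-unique a {F} {g} {h} g-sol h-sol t m = below (suc m) t m ℕₚ.≤-refl
  where
  below : ∀ n t m → m < n → g t m ≡ h t m
  below (suc n) t m (s≤s m≤n) = begin
    g t m                                 ≡⟨ g-sol t m ⟩
    F t m + shift (suc a) (g (suc t)) m   ≡⟨ +-congˡ (F t m) (shift-cong-< a m (λ j j<m → below n (suc t) j (ℕₚ.≤-trans j<m m≤n))) ⟩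
    F t m + shift (suc a) (h (suc t)) m   ≡⟨ h-sol t m ⟨
    h t m                                 ∎

-- The series truncated at N = n. The term with index N starts in degree at least N, so fuel `m`
-- already gives the exact coefficient at `m`.
solFuel : ℕ → ℕ → Family → Family
solFuel zero    a F t m = F t m
solFuel (suc n) a F t m = F t m + shift (suc a) (solFuel n a F (suc t)) m

solFuel-stable : ∀ n n′ a F t m → m ≤ n → m ≤ n′ → solFuel n a F t m ≡ solFuel n′ a F t m
solFuel-stable zero    zero     a F t m    _   _    = refl
solFuel-stable zero    (suc n′) a F t zero _   _    = sym (ℤₚ.+-identityʳ _)
solFuel-stable (suc n) zero     a F t zero _   _    = ℤₚ.+-identityʳ _
solFuel-stable (suc n) (suc n′) a F t m    m≤n m≤n′ = +-congˡ (F t m)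
  (shift-cong-< a m (λ j j<m → solFuel-stable n n′ a F (suc t) j
    (ℕ.s≤s⁻¹ (ℕₚ.≤-trans j<m m≤n)) (ℕ.s≤s⁻¹ (ℕₚ.≤-trans j<m m≤n′))))

-- The sum over N of q^{(a+1)N} F_{t+N}.
Sol : ℕ → Family → Family
Sol a F t m = solFuel m a F t m

Sol-isSol : ∀ a F → IsSol a F (Sol a F)
Sol-isSol a F t m = begin
  solFuel m a F t m                      ≡⟨ solFuel-stable m (suc m) a F t m ℕₚ.≤-refl (ℕₚ.n≤1+n m) ⟩
  F t m + shift (suc a) (solFuel m a F (suc t)) m
    ≡⟨ +-congˡ (F t m) (shift-cong-≤ (suc a) m (λ j j≤m → solFuel-stable m j a F (suc t) j j≤m ℕₚ.≤-refl)) ⟩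
  F t m + shift (suc a) (Sol a F (suc t)) m ∎

Sol-unique : ∀ a {F g} → IsSol a F g → g ≋ Sol a F
Sol-unique a {F} g-sol = IsSol-unique a {F} g-sol (Sol-isSol a F)

Sol-cong : ∀ a {F G} → F ≋ G → Sol a F ≋ Sol a G
Sol-cong a {F} eq = Sol-unique a (λ t m → trans (Sol-isSol a F t m) (cong₂ _+_ (eq t m) refl))

Sol-⊕ : ∀ a F G → Sol a (λ t → F t ⊕ G t) ≋ λ t → Sol a F t ⊕ Sol a G t
Sol-⊕ a F G t m = sym (Sol-unique a sum-sol t m)
  where
  sum-sol : IsSol a (λ t → F t ⊕ G t) (λ t → Sol a F t ⊕ Sol a G t)
  sum-sol t m = begin
    Sol a F t m + Sol a G t m  ≡⟨ cong₂ _+_ (Sol-isSol a F t m) (Sol-isSol a G t m) ⟩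
    (F t m + shift (suc a) (Sol a F (suc t)) m) + (G t m + shift (suc a) (Sol a G (suc t)) m)
      ≡⟨ interchange (F t m) _ (G t m) _ ⟩
    (F t m + G t m) + (shift (suc a) (Sol a F (suc t)) m + shift (suc a) (Sol a G (suc t)) m)
      ≡⟨ +-congˡ (F t m + G t m) (shift-⊕ (suc a) (Sol a F (suc t)) (Sol a G (suc t)) m) ⟨
    (F t m + G t m) + shift (suc a) (Sol a F (suc t) ⊕ Sol a G (suc t)) m ∎

Sol-shift : ∀ a c F → Sol a (λ t → shift c (F t)) ≋ λ t → shift c (Sol a F t)
Sol-shift a c F t m = sym (Sol-unique a shift-sol t m)
  where
  shift-sol : IsSol a (λ t → shift c (F t)) (λ t → shift c (Sol a F t))
  shift-sol t m = begin
    shift c (Sol a F t) m                                         ≡⟨ shift-cong c (Sol-isSol a F t) m ⟩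
    shift c (F t ⊕ shift (suc a) (Sol a F (suc t))) m             ≡⟨ shift-⊕ c (F t) _ m ⟩
    shift c (F t) m + shift c (shift (suc a) (Sol a F (suc t))) m ≡⟨ +-congˡ (shift c (F t) m) (shift-comm c (suc a) (Sol a F (suc t)) m) ⟩
    shift c (F t) m + shift (suc a) (shift c (Sol a F (suc t))) m ∎

Sol-suc : ∀ a F t → Sol a F (suc t) ≈ Sol a (λ t → F (suc t)) t
Sol-suc a F t m = Sol-unique a (λ t m → Sol-isSol a F (suc t) m) t m

-- `Sol a` is additive and commutes with shifts and with advancing the offset. It therefore carries
-- the recurrence of `Sol b F` to the one that determines `Sol b (Sol a F)`.
Sol-comm : ∀ a b F → Sol a (Sol b F) ≋ Sol b (Sol a F)
Sol-comm a b F = Sol-unique b comm-sol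
  where
  comm-sol : IsSol b (Sol a F) (Sol a (Sol b F))
  comm-sol t m = begin
    Sol a (Sol b F) t m ≡⟨ Sol-cong a (Sol-isSol b F) t m ⟩
    Sol a (λ t → F t ⊕ shift (suc b) (Sol b F (suc t))) t m ≡⟨ Sol-⊕ a F _ t m ⟩
    Sol a F t m + Sol a (λ t → shift (suc b) (Sol b F (suc t))) t m ≡⟨ +-congˡ (Sol a F t m) (Sol-shift a (suc b) _ t m) ⟩
    Sol a F t m + shift (suc b) (Sol a (λ t → Sol b F (suc t)) t) m ≡⟨ +-congˡ (Sol a F t m) (shift-cong (suc b) (Sol-suc a (Sol b F) t) m) ⟨
    Sol a F t m + shift (suc b) (Sol a (Sol b F) (suc t)) m ∎

-- AddParts k d F t counts pairs of a partition with N parts, all in k+1, …, k+d, and an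
-- object counted by F_{t+N}; the number N of parts is recorded by the offset only.
AddParts : ℕ → ℕ → Family → Family
AddParts k zero    F = F
AddParts k (suc d) F = Sol (k ℕ.+ d) (AddParts k d F)

AddParts-cong : ∀ k d {F G} → F ≋ G → AddParts k d F ≋ AddParts k d G
AddParts-cong k zero    eq = eq
AddParts-cong k (suc d) eq = Sol-cong (k ℕ.+ d) (AddParts-cong k d eq)

AddParts-⊕ : ∀ k d F G → AddParts k d (λ t → F t ⊕ G t) ≋ λ t → AddParts k d F t ⊕ AddParts k d G t
AddParts-⊕ k zero    F G t m = refl
AddParts-⊕ k (suc d) F G t m = trans (Sol-cong (k ℕ.+ d) (AddParts-⊕ k d F G) t m) (Sol-⊕ (k ℕ.+ d) (AddParts k d F) (AddParts k d G) t m)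

AddParts-shift : ∀ k d c F → AddParts k d (λ t → shift c (F t)) ≋ λ t → shift c (AddParts k d F t)
AddParts-shift k zero    c F t m = refl
AddParts-shift k (suc d) c F t m = trans (Sol-cong (k ℕ.+ d) (AddParts-shift k d c F) t m) (Sol-shift (k ℕ.+ d) c (AddParts k d F) t m)

AddParts-suc : ∀ k d F t → AddParts k d F (suc t) ≈ AddParts k d (λ t → F (suc t)) t
AddParts-suc k zero    F t m = refl
AddParts-suc k (suc d) F t m = trans (Sol-suc (k ℕ.+ d) (AddParts k d F) t m) (Sol-cong (k ℕ.+ d) (AddParts-suc k d F) t m)

-- `AddParts` adjoins the sizes in increasing order, which leaves `k + 1` innermost. Commuting the
-- operators brings it outermost, where its recurrence can be used.
AddParts-bottom : ∀ k d F → AddParts k (suc d) F ≋ Sol k (AddParts (suc k) d F)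
AddParts-bottom k zero    F t m = cong (λ a → Sol a F t m) (ℕₚ.+-identityʳ k)
AddParts-bottom k (suc d) F t m = begin
  Sol (k ℕ.+ suc d) (AddParts k (suc d) F) t m            ≡⟨ Sol-cong (k ℕ.+ suc d) (AddParts-bottom k d F) t m ⟩
  Sol (k ℕ.+ suc d) (Sol k (AddParts (suc k) d F)) t m    ≡⟨ Sol-comm (k ℕ.+ suc d) k (AddParts (suc k) d F) t m ⟩
  Sol k (Sol (k ℕ.+ suc d) (AddParts (suc k) d F)) t m    ≡⟨ cong (λ a → Sol k (Sol a (AddParts (suc k) d F)) t m) (ℕₚ.+-suc k d) ⟩
  Sol k (AddParts (suc k) (suc d) F) t m ∎

Sol-small : ∀ a F t m → m ≤ a → Sol a F t m ≡ F t m
Sol-small a F t m m≤a = begin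
  Sol a F t m                                ≡⟨ Sol-isSol a F t m ⟩
  F t m + shift (suc a) (Sol a F (suc t)) m  ≡⟨ +-congˡ (F t m) (shift-> (suc a) _ m (s≤s m≤a)) ⟩
  F t m + 0ℤ                                 ≡⟨ ℤₚ.+-identityʳ _ ⟩
  F t m                                      ∎

AddParts-stable : ∀ k F t {m d} → m ≤′ d → AddParts k d F t m ≡ AddParts k m F t m
AddParts-stable k F t         ≤′-refl         = refl
AddParts-stable k F t {m} {suc d} (≤′-step m≤d) =
  trans (Sol-small (k ℕ.+ d) (AddParts k d F) t m (ℕₚ.≤-trans (ℕₚ.≤′⇒≤ m≤d) (ℕₚ.m≤n+m d k))) (AddParts-stable k F t m≤d)

AddParts-small : ∀ k d F t m → m ≤ k → AddParts k d F t m ≡ F t m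
AddParts-small k zero    F t m m≤k = refl
AddParts-small k (suc d) F t m m≤k =
  trans (Sol-small (k ℕ.+ d) (AddParts k d F) t m (ℕₚ.≤-trans m≤k (ℕₚ.m≤m+n k d))) (AddParts-small k d F t m m≤k)

-- Parts larger than m do not matter for the coefficient at m.
AddParts∞ : ℕ → Family → Family
AddParts∞ k F t m = AddParts k m F t m

AddParts∞-cong : ∀ k {F G} → F ≋ G → AddParts∞ k F ≋ AddParts∞ k G
AddParts∞-cong k eq t m = AddParts-cong k m eq t m

AddParts∞-⊕ : ∀ k F G → AddParts∞ k (λ t → F t ⊕ G t) ≋ λ t → AddParts∞ k F t ⊕ AddParts∞ k G t
AddParts∞-⊕ k F G t m = AddParts-⊕ k m F G t m

AddParts∞-shift : ∀ k c F → AddParts∞ k (λ t → shift c (F t)) ≋ λ t → shift c (AddParts∞ k F t)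
AddParts∞-shift k c F t m = trans (AddParts-shift k m c F t m)
  (shift-cong-≤ c m (λ j j≤m → AddParts-stable k F t (ℕₚ.≤⇒≤′ j≤m)))

AddParts∞-small : ∀ k F t m → m ≤ k → AddParts∞ k F t m ≡ F t m
AddParts∞-small k F t m m≤k = AddParts-small k m F t m m≤k

-- Either no part equals `k + 1`, or one such part is removed and the offset records it.
AddParts∞-bottom : ∀ k F t → AddParts∞ k F t ≈ AddParts∞ (suc k) F t ⊕ shift (suc k) (AddParts∞ k (λ t → F (suc t)) t)
AddParts∞-bottom k F t m = begin
  AddParts k m F t m                 ≡⟨ AddParts-stable k F t (≤′-step {m} ≤′-refl) ⟨
  AddParts k (suc m) F t m           ≡⟨ AddParts-bottom k m F t m ⟩
  Sol k (AddParts (suc k) m F) t m   ≡⟨ Sol-isSol k (AddParts (suc k) m F) t m ⟩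
  AddParts (suc k) m F t m + shift (suc k) (Sol k (AddParts (suc k) m F) (suc t)) m
    ≡⟨ +-congˡ (AddParts (suc k) m F t m) (shift-cong-≤ (suc k) m tail) ⟩
  AddParts (suc k) m F t m + shift (suc k) (AddParts∞ k (λ t → F (suc t)) t) m ∎
  where
  tail : ∀ j → j ≤ m → Sol k (AddParts (suc k) m F) (suc t) j ≡ AddParts∞ k (λ t → F (suc t)) t j
  tail j j≤m = begin
    Sol k (AddParts (suc k) m F) (suc t) j  ≡⟨ AddParts-bottom k m F (suc t) j ⟨
    AddParts k (suc m) F (suc t) j          ≡⟨ AddParts-stable k F (suc t) (≤′-step (ℕₚ.≤⇒≤′ j≤m)) ⟩
    AddParts k j F (suc t) j                ≡⟨ AddParts-suc k j F t j ⟩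
    AddParts k j (λ t → F (suc t)) t j      ∎

Sol-single : ∀ a F → (∀ t → F (suc t) ≈ λ _ → 0ℤ) → ∀ t → Sol a F (suc t) ≈ λ _ → 0ℤ
Sol-single a F F≈0 t m = trans (Sol-suc a F t m) (sym (Sol-unique a {g = λ _ _ → 0ℤ}
  (λ t m → sym (cong₂ _+_ (F≈0 t m) (shift-0 (suc a) m))) t m))

-- Every adjoined part advances the offset, so a family concentrated at offset 0 sees only the empty
-- collection of parts.
AddParts-single : ∀ k d F → (∀ t → F (suc t) ≈ λ _ → 0ℤ) →
           (AddParts k d F 0 ≈ F 0) × (∀ t → AddParts k d F (suc t) ≈ λ _ → 0ℤ)
AddParts-single k zero    F F≈0 = (λ _ → refl) , F≈0
AddParts-single k (suc d) F F≈0 with AddParts-single k d F F≈0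
... | head , tail = head′ , Sol-single (k ℕ.+ d) (AddParts k d F) tail
  where
  head′ : Sol (k ℕ.+ d) (AddParts k d F) 0 ≈ F 0
  head′ m = begin
    Sol (k ℕ.+ d) (AddParts k d F) 0 m ≡⟨ Sol-isSol (k ℕ.+ d) (AddParts k d F) 0 m ⟩
    AddParts k d F 0 m + shift (suc (k ℕ.+ d)) (Sol (k ℕ.+ d) (AddParts k d F) 1) m
      ≡⟨ cong₂ _+_ (head m) (trans (shift-cong (suc (k ℕ.+ d)) (Sol-single (k ℕ.+ d) (AddParts k d F) tail 0) m) (shift-0 (suc (k ℕ.+ d)) m)) ⟩
    F 0 m + 0ℤ                  ≡⟨ ℤₚ.+-identityʳ _ ⟩
    F 0 m ∎

-- Recursion on the largest part

branch : (ℕ → List (List ℕ)) → ℕ → ℕ → List (List ℕ)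
branch h b m = concatMap (λ p → map (λ λs → p ∷ λs) (h p)) (filterᵇ (λ p → p ≤ᵇ m) (map suc (upTo b)))

-- One step of `go` with `h` in place of the recursive calls; comparing the two is what solves the
-- underscores.
unfold : (ℕ → ℕ → ℕ → List (List ℕ)) → ℕ → ℕ → ℕ → List (List ℕ)
unfold h fuel       b zero    = [] ∷ []
unfold h zero       b (suc m) = []
unfold h (suc fuel) b (suc m) = branch (h fuel m) b (suc m)

-- The local function go of partsLE has no name outside Defs.  The underscores below are
-- solved by unification: go₁ and go₂ are go with third argument suc m ∸ p and suc x ∸ p.
mutual
  go₁ : ℕ → ℕ → ℕ → ℕ → List (List ℕ)
  go₁ = λ b m w p → _

  partsLE-unfold : ∀ b m → partsLE b m ≡ unfold (λ w m p → go₁ b m w p) (suc m) b m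
  -- With the fuel abstracted to a variable, `go₁` is applied to distinct variables, as unification
  -- requires.
  partsLE-unfold b m with suc m
  partsLE-unfold b zero    | w     = refl
  partsLE-unfold b (suc m) | zero  = refl
  partsLE-unfold b (suc m) | suc w = refl

mutual
  go₂ : ℕ → ℕ → ℕ → ℕ → ℕ → List (List ℕ)
  go₂ = λ b m w x p → _

  go₁-unfold : ∀ b m w p → go₁ b m w p ≡ unfold (go₂ b m) w p (suc m ∸ p)
  go₁-unfold b m w       p with suc m ∸ p
  go₁-unfold b m w       p | zero  = refl
  go₁-unfold b m zero    p | suc x = refl
  go₁-unfold b m (suc w) p | suc x = refl

-- The recursive calls of `go₂` have the form of `go₂` again, so the unfolding closes up here.
go₂-unfold : ∀ b m w x p → go₂ b m w x p ≡ unfold (go₂ b m) w p (suc x ∸ p)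
go₂-unfold b m w       x p with suc x ∸ p
go₂-unfold b m w       x p | zero  = refl
go₂-unfold b m zero    x p | suc y = refl
go₂-unfold b m (suc w) x p | suc y = refl

branch-suc : ∀ h b m → branch h (suc b) m ≡
  branch h b m ++ (if suc b ≤ᵇ m then map (suc b ∷_) (h (suc b)) else [])
branch-suc h b m = begin
  concatMap f (filterᵇ q (map suc (upTo (suc b))))
    ≡⟨ cong (λ xs → concatMap f (filterᵇ q (map suc xs))) (Listₚ.upTo-∷ʳ b) ⟨
  concatMap f (filterᵇ q (map suc (upTo b ++ b ∷ [])))
    ≡⟨ cong (λ xs → concatMap f (filterᵇ q xs)) (Listₚ.map-++ suc (upTo b) (b ∷ [])) ⟩
  concatMap f (filterᵇ q (map suc (upTo b) ++ suc b ∷ []))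
    ≡⟨ cong (concatMap f) (Listₚ.filter-++ (λ p → T? (q p)) (map suc (upTo b)) (suc b ∷ [])) ⟩
  concatMap f (filterᵇ q (map suc (upTo b)) ++ filterᵇ q (suc b ∷ []))
    ≡⟨ Listₚ.concatMap-++ f (filterᵇ q (map suc (upTo b))) (filterᵇ q (suc b ∷ [])) ⟩
  branch h b m ++ concatMap f (filterᵇ q (suc b ∷ []))
    ≡⟨ cong (branch h b m ++_) last ⟩
  branch h b m ++ (if suc b ≤ᵇ m then map (suc b ∷_) (h (suc b)) else []) ∎
  where
  f : ℕ → List (List ℕ)
  f p = map (p ∷_) (h p)

  q : ℕ → Bool
  q p = p ≤ᵇ m

  last : concatMap f (filterᵇ q (suc b ∷ [])) ≡ (if suc b ≤ᵇ m then map (suc b ∷_) (h (suc b)) else [])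
  last with suc b ≤ᵇ m
  ... | true  = Listₚ.++-identityʳ _
  ... | false = refl

branch-cong : ∀ {h h′} b m → (∀ p → h (suc p) ≡ h′ (suc p)) → branch h b m ≡ branch h′ b m
branch-cong         zero    m eq = refl
branch-cong {h} {h′} (suc b) m eq = begin
  branch h (suc b) m ≡⟨ branch-suc h b m ⟩
  branch h b m ++ (if suc b ≤ᵇ m then map (suc b ∷_) (h (suc b)) else [])
    ≡⟨ cong₂ (λ xs ys → xs ++ (if suc b ≤ᵇ m then map (suc b ∷_) ys else [])) (branch-cong b m eq) (eq b) ⟩
  branch h′ b m ++ (if suc b ≤ᵇ m then map (suc b ∷_) (h′ (suc b)) else [])
    ≡⟨ branch-suc h′ b m ⟨
  branch h′ (suc b) m ∎

-- A named copy of `go`, for which independence of the fuel can be stated.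
parts : ℕ → ℕ → ℕ → List (List ℕ)
parts fuel       b zero    = [] ∷ []
parts zero       b (suc m) = []
parts (suc fuel) b (suc m) = branch (λ p → parts fuel p (suc m ∸ p)) b (suc m)

mutual
  go₂≡parts : ∀ b m w x p → go₂ b m w x p ≡ parts w p (suc x ∸ p)
  go₂≡parts b m w x p = trans (go₂-unfold b m w x p) (unfold≡parts b m w p (suc x ∸ p))

  unfold≡parts : ∀ b m w p y → unfold (go₂ b m) w p y ≡ parts w p y
  unfold≡parts b m w       p zero    = refl
  unfold≡parts b m zero    p (suc y) = refl
  unfold≡parts b m (suc w) p (suc y) = branch-cong p (suc y) (λ q → go₂≡parts b m w y (suc q))

partsLE≡parts : ∀ b m → partsLE b m ≡ parts (suc m) b m
partsLE≡parts b zero    = partsLE-unfold b zero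
partsLE≡parts b (suc m) = trans (partsLE-unfold b (suc m))
  (branch-cong b (suc m) (λ p → trans (go₁-unfold b m (suc m) (suc p)) (unfold≡parts b m (suc m) (suc p) (m ∸ p))))

parts-stable : ∀ w w′ b m → m ≤ w → m ≤ w′ → parts w b m ≡ parts w′ b m
parts-stable w       w′       b zero    _         _          = refl
parts-stable (suc w) (suc w′) b (suc m) (s≤s m≤w) (s≤s m≤w′) = branch-cong b (suc m)
  (λ p → parts-stable w w′ (suc p) (m ∸ p) (ℕₚ.≤-trans (ℕₚ.m∸n≤m m p) m≤w) (ℕₚ.≤-trans (ℕₚ.m∸n≤m m p) m≤w′))

-- Candidates for the first part are listed in increasing order, so raising the bound only appends
-- the partitions with largest part `b + 1`. The later counts rest on this recursion.
partsLE-suc : ∀ b m → partsLE (suc b) m ≡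
  partsLE b m ++ (if suc b ≤ᵇ m then map (suc b ∷_) (partsLE (suc b) (m ∸ suc b)) else [])
partsLE-suc b zero    = refl
partsLE-suc b (suc m) = begin
  partsLE (suc b) (suc m) ≡⟨ partsLE≡parts (suc b) (suc m) ⟩
  branch (λ p → parts (suc m) p (suc m ∸ p)) (suc b) (suc m) ≡⟨ branch-suc _ b (suc m) ⟩
  parts (suc (suc m)) b (suc m) ++ (if b <ᵇ suc m then map (suc b ∷_) (parts (suc m) (suc b) (m ∸ b)) else [])
    ≡⟨ cong₂ (λ xs ys → xs ++ (if b <ᵇ suc m then map (suc b ∷_) ys else []))
             (sym (partsLE≡parts b (suc m)))
             (trans (parts-stable (suc m) (suc (m ∸ b)) (suc b) (m ∸ b)
                       (ℕₚ.≤-trans (ℕₚ.m∸n≤m m b) (ℕₚ.n≤1+n m)) (ℕₚ.n≤1+n (m ∸ b)))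
                    (sym (partsLE≡parts (suc b) (m ∸ b)))) ⟩
  partsLE b (suc m) ++ (if b <ᵇ suc m then map (suc b ∷_) (partsLE (suc b) (m ∸ b)) else []) ∎

-- Weighted sums over partitions with bounded parts

wsum : (List ℕ → ℤ) → List (List ℕ) → ℤ
wsum w []         = 0ℤ
wsum w (λs ∷ λss) = w λs + wsum w λss

wsum-++ : ∀ w xs ys → wsum w (xs ++ ys) ≡ wsum w xs + wsum w ys
wsum-++ w []       ys = sym (ℤₚ.+-identityˡ _)
wsum-++ w (x ∷ xs) ys = trans (+-congˡ (w x) (wsum-++ w xs ys)) (sym (ℤₚ.+-assoc (w x) _ _))

wsum-map : ∀ w p xs → wsum w (map (p ∷_) xs) ≡ wsum (λ λs → w (p ∷ λs)) xs
wsum-map w p []       = refl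
wsum-map w p (x ∷ xs) = +-congˡ (w (p ∷ x)) (wsum-map w p xs)

total : (List ℕ → ℤ) → ℕ → Seq
total w b m = wsum w (partsLE b m)

total-suc : ∀ w b → total w (suc b) ≈ total w b ⊕ shift (suc b) (total (λ λs → w (suc b ∷ λs)) (suc b))
total-suc w b m = begin
  wsum w (partsLE (suc b) m) ≡⟨ cong (wsum w) (partsLE-suc b m) ⟩
  wsum w (partsLE b m ++ (if suc b ≤ᵇ m then map (suc b ∷_) (partsLE (suc b) (m ∸ suc b)) else []))
    ≡⟨ wsum-++ w (partsLE b m) _ ⟩
  total w b m + wsum w (if suc b ≤ᵇ m then map (suc b ∷_) (partsLE (suc b) (m ∸ suc b)) else [])
    ≡⟨ +-congˡ (total w b m) (last (suc b ≤ᵇ m)) ⟩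
  total w b m + (if suc b ≤ᵇ m then total (λ λs → w (suc b ∷ λs)) (suc b) (m ∸ suc b) else 0ℤ)
    ≡⟨ +-congˡ (total w b m) (shift-if (suc b) _ m) ⟨
  total w b m + shift (suc b) (total (λ λs → w (suc b ∷ λs)) (suc b)) m ∎
  where
  last : ∀ c → wsum w (if c then map (suc b ∷_) (partsLE (suc b) (m ∸ suc b)) else [])
             ≡ (if c then total (λ λs → w (suc b ∷ λs)) (suc b) (m ∸ suc b) else 0ℤ)
  last true  = wsum-map w (suc b) (partsLE (suc b) (m ∸ suc b))
  last false = refl

-- The partitions of `m` into parts at most `b`, generated by the recursion of `total-suc`. Thus
-- `total-cong` needs no reasoning about membership in `partsLE b m`.
data Part : ℕ → ℕ → List ℕ → Set where
  nil    : ∀ {b} → Part b 0 []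
  weaken : ∀ {b m λs} → Part b m λs → Part (suc b) m λs
  cons   : ∀ {b m λs} → Part (suc b) m λs → Part (suc b) (suc b ℕ.+ m) (suc b ∷ λs)

total-cong : ∀ {w w′} b m → (∀ {λs} → Part b m λs → w λs ≡ w′ λs) → total w b m ≡ total w′ b m
total-cong b m = below (suc m) b m ℕₚ.≤-refl
  where
  below : ∀ n {w w′} b m → m < n → (∀ {λs} → Part b m λs → w λs ≡ w′ λs) → total w b m ≡ total w′ b m
  below n zero    zero    m<n eq = cong (_+ 0ℤ) (eq nil)
  below n zero    (suc m) m<n eq = refl
  -- Lowering the bound keeps the fuel; removing a part `b + 1` lowers the degree, which pays for
  -- keeping the bound `suc b`.
  below (suc n) {w} {w′} (suc b) m (s≤s m≤n) eq = begin
    total w (suc b) m ≡⟨ total-suc w b m ⟩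
    total w b m + shift (suc b) (total (λ λs → w (suc b ∷ λs)) (suc b)) m
      ≡⟨ cong₂ _+_ (below (suc n) b m (s≤s m≤n) (λ part → eq (weaken part)))
           (shift-cong-at (suc b) m λ j b+j≡m → below n (suc b) j
              (ℕₚ.≤-trans (subst (j <_) b+j≡m (s≤s (ℕₚ.m≤n+m j b))) m≤n)
              (λ part → eq (subst (λ m → Part (suc b) m _) b+j≡m (cons part)))) ⟩
    total w′ b m + shift (suc b) (total (λ λs → w′ (suc b ∷ λs)) (suc b)) m
      ≡⟨ total-suc w′ b m ⟨
    total w′ (suc b) m ∎

Part-≤ : ∀ {b m λs} → Part b m λs → All (_≤ b) λs
Part-≤ nil           = []
Part-≤ (weaken part) = All.map ℕₚ.m≤n⇒m≤1+n (Part-≤ part)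
Part-≤ (cons part)   = ℕₚ.≤-refl ∷ Part-≤ part

Part-length : ∀ {b m λs} → Part b m λs → length λs ≤ m
Part-length nil                  = z≤n
Part-length (weaken part)        = Part-length part
Part-length (cons {b} {m} part)  = s≤s (ℕₚ.≤-trans (Part-length part) (ℕₚ.m≤n+m m b))

-- Minimal excludants

containsAll : ℕ → List ℕ → Bool
containsAll zero    λs = true
containsAll (suc j) λs = containsAll j λs ∧ elemᵇ (suc j) λs

elemᵇ-here : ∀ x λs → elemᵇ x (x ∷ λs) ≡ true
elemᵇ-here x λs = cong (λ c → if c then true else elemᵇ x λs) (dec-true (x ℕₚ.≟ x) refl)

elemᵇ-there : ∀ {x y} λs → x ≢ y → elemᵇ x (y ∷ λs) ≡ elemᵇ x λs
elemᵇ-there {x} {y} λs x≢y = cong (λ c → if c then true else elemᵇ x λs) (dec-false (x ℕₚ.≟ y) x≢y)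

elemᵇ-> : ∀ {x b λs} → b < x → All (_≤ b) λs → elemᵇ x λs ≡ false
elemᵇ-> b<x []                        = refl
elemᵇ-> b<x (_∷_ {xs = λs} y≤b λs≤b)  =
  trans (elemᵇ-there λs (ℕₚ.>⇒≢ (ℕₚ.≤-<-trans y≤b b<x))) (elemᵇ-> b<x λs≤b)

elemᵇ⇒Any : ∀ x λs → elemᵇ x λs ≡ true → Any (x ≡_) λs
elemᵇ⇒Any x (y ∷ λs) eq with x ℕₚ.≟ y
... | yes x≡y = here x≡y
... | no  x≢y = there (elemᵇ⇒Any x λs (trans (sym (elemᵇ-there λs x≢y)) eq))

containsAll-skip : ∀ {c x} λs → c < x → containsAll c (x ∷ λs) ≡ containsAll c λs
containsAll-skip {zero}  λs c<x = refl
containsAll-skip {suc c} λs c<x =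
  cong₂ _∧_ (containsAll-skip λs (ℕₚ.<-trans (ℕₚ.n<1+n c) c<x)) (elemᵇ-there λs (ℕₚ.<⇒≢ c<x))

containsAll-≤ : ∀ {i j} λs → i ≤′ j → containsAll j λs ≡ true → containsAll i λs ≡ true
containsAll-≤         λs ≤′-refl             all = all
containsAll-≤ {j = suc j} λs (≤′-step i≤j) all with containsAll j λs in eq
... | true = containsAll-≤ λs i≤j eq

containsAll⇒elemᵇ : ∀ {i j} λs → i < j → containsAll j λs ≡ true → elemᵇ (suc i) λs ≡ true
containsAll⇒elemᵇ {i} λs i<j all with containsAll i λs | containsAll-≤ λs (ℕₚ.≤⇒≤′ i<j) all
... | true | eq = eq

-- Distinct values sit at distinct positions, so the pigeonhole principle applies. This is why the
-- fuel in `mex` suffices.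
containsAll⇒≤length : ∀ j λs → containsAll j λs ≡ true → j ≤ length λs
containsAll⇒≤length j λs all = ℕₚ.≮⇒≥ too-many
  where
  member : (i : Fin j) → Any (suc (toℕ i) ≡_) λs
  member i = elemᵇ⇒Any (suc (toℕ i)) λs (containsAll⇒elemᵇ λs (Finₚ.toℕ<n i) all)

  too-many : ¬ length λs < j
  too-many length<j with Finₚ.pigeonhole length<j (λ i → Any.index (member i))
  ... | i , i′ , i<i′ , same = ℕₚ.<⇒≢ i<i′ (ℕₚ.suc-injective (begin
    suc (toℕ i)                          ≡⟨ Anyₚ.lookup-index (member i) ⟩
    lookup λs (Any.index (member i))     ≡⟨ cong (lookup λs) same ⟩
    lookup λs (Any.index (member i′))    ≡⟨ Anyₚ.lookup-index (member i′) ⟨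
    suc (toℕ i′)                         ∎))

record IsMex (c : ℕ) (λs : List ℕ) : Set where
  field
    mex≡suc : mex λs ≡ suc c
    all     : containsAll c λs ≡ true
    none    : elemᵇ (suc c) λs ≡ false

mex-spec : ∀ λs → Σ[ c ∈ ℕ ] IsMex c λs
mex-spec λs = search (suc (length λs)) 0 refl (ℕₚ.n<1+n _) refl
  where
  search : ∀ f i → containsAll i λs ≡ true → length λs < i ℕ.+ f → mex λs ≡ mexFrom f (suc i) λs → Σ[ c ∈ ℕ ] IsMex c λs
  -- Running out of fuel would put 1, ..., i into a list of fewer than `i` entries.
  search zero    i all length< eq = contradiction
    (containsAll⇒≤length i λs all) (ℕₚ.<⇒≱ (subst (length λs <_) (ℕₚ.+-identityʳ i) length<))
  search (suc f) i all length< eq with elemᵇ (suc i) λs in here?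
  ... | true  = search f (suc i) (cong₂ _∧_ all here?) (subst (length λs <_) (ℕₚ.+-suc i f) length<) eq
  ... | false = i , record { mex≡suc = eq ; all = all ; none = here? }

containsAll≡<ᵇmex : ∀ j λs → containsAll j λs ≡ (j <ᵇ mex λs)
containsAll≡<ᵇmex j λs with mex-spec λs
... | c , is-mex with j ℕₚ.<? suc c
...   | yes j<suc-c = trans (containsAll-≤ λs (ℕₚ.≤⇒≤′ (ℕ.s≤s⁻¹ j<suc-c)) all)
                            (sym (trans (cong (j <ᵇ_) mex≡suc) (dec-true (j ℕₚ.<? suc c) j<suc-c)))
  where open IsMex is-mex
...   | no  j≮suc-c = trans not-all (sym (trans (cong (j <ᵇ_) mex≡suc) (dec-false (j ℕₚ.<? suc c) j≮suc-c)))
  where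
  open IsMex is-mex

  not-all : containsAll j λs ≡ false
  not-all with containsAll j λs in eq
  ... | false = refl
  ... | true  = contradiction (trans (sym (containsAll⇒elemᵇ λs (ℕₚ.≮⇒≥ j≮suc-c) eq)) none) (λ ())

mex≡ᵇ : ∀ c λs → (mex λs ≡ᵇ suc c) ≡ containsAll c λs ∧ not (elemᵇ (suc c) λs)
mex≡ᵇ c λs with mex-spec λs
... | c′ , is-mex with ℕₚ.<-cmp c c′
...   | tri< c<c′ c≢c′ _ = begin
  mex λs ≡ᵇ suc c       ≡⟨ cong (_≡ᵇ suc c) mex≡suc ⟩
  suc c′ ≡ᵇ suc c       ≡⟨ dec-false (suc c′ ℕₚ.≟ suc c) (λ eq → c≢c′ (sym (ℕₚ.suc-injective eq))) ⟩
  false                 ≡⟨ ∧-zeroʳ (containsAll c λs) ⟨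
  containsAll c λs ∧ not true ≡⟨ cong (λ x → containsAll c λs ∧ not x) (containsAll⇒elemᵇ λs c<c′ all) ⟨
  containsAll c λs ∧ not (elemᵇ (suc c) λs) ∎
  where open IsMex is-mex
...   | tri≈ _ refl _ = begin
  mex λs ≡ᵇ suc c       ≡⟨ cong (_≡ᵇ suc c) mex≡suc ⟩
  suc c ≡ᵇ suc c        ≡⟨ dec-true (suc c ℕₚ.≟ suc c) refl ⟩
  true                  ≡⟨ cong₂ (λ x y → x ∧ not y) all none ⟨
  containsAll c λs ∧ not (elemᵇ (suc c) λs) ∎
  where open IsMex is-mex
...   | tri> _ c≢c′ c′<c = begin
  mex λs ≡ᵇ suc c       ≡⟨ cong (_≡ᵇ suc c) mex≡suc ⟩
  suc c′ ≡ᵇ suc c       ≡⟨ dec-false (suc c′ ℕₚ.≟ suc c) (λ eq → c≢c′ (sym (ℕₚ.suc-injective eq))) ⟩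
  false                 ≡⟨ cong (λ x → x ∧ not (elemᵇ (suc c) λs)) not-all ⟨
  containsAll c λs ∧ not (elemᵇ (suc c) λs) ∎
  where
  open IsMex is-mex

  not-all : containsAll c λs ≡ false
  not-all with containsAll c λs in eq
  ... | false = refl
  ... | true  = contradiction (trans (sym (containsAll⇒elemᵇ λs c′<c eq)) none) (λ ())

⟦_⟧ : Bool → ℤ
⟦ b ⟧ = if b then 1ℤ else 0ℤ

-- Counting by peeling off largest parts

one : Seq
one zero    = 1ℤ
one (suc m) = 0ℤ

-- The Gaussian binomial coefficient [t, i], defined by the q-Pascal rule; it counts partitions into
-- at most t - i parts, each at most `i`.
qbin : ℕ → ℕ → Seq
qbin t       zero    = one
qbin zero    (suc i) = λ _ → 0ℤ
qbin (suc t) (suc i) = qbin t i ⊕ shift (suc i) (qbin t (suc i))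

-- qbin⁻ t i is [t − 1, i], with value 0 at t = 0 also for i = 0.
qbin⁻ : ℕ → ℕ → Seq
qbin⁻ zero    i = λ _ → 0ℤ
qbin⁻ (suc t) i = qbin t i

tri : ℕ → ℕ
tri zero    = 0
tri (suc j) = suc j ℕ.+ tri j

partsSeq : ℕ → Seq
partsSeq = total (λ _ → 1ℤ)

partitionSeq : Seq
partitionSeq m = partsSeq m m

total-stable : ∀ w {b m} → m ≤′ b → total w b m ≡ total w m m
total-stable w             ≤′-refl       = refl
total-stable w {suc b} {m} (≤′-step m≤b) = begin
  total w (suc b) m  ≡⟨ total-suc w b m ⟩
  total w b m + shift (suc b) (total (λ λs → w (suc b ∷ λs)) (suc b)) m
    ≡⟨ cong₂ _+_ (total-stable w m≤b) (shift-> (suc b) _ m (s≤s (ℕₚ.≤′⇒≤ m≤b))) ⟩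
  total w m m + 0ℤ   ≡⟨ ℤₚ.+-identityʳ _ ⟩
  total w m m ∎

total-0 : ∀ b → total (λ _ → 0ℤ) b ≈ λ _ → 0ℤ
total-0 b m = wsum-0 (partsLE b m)
  where
  wsum-0 : ∀ xs → wsum (λ _ → 0ℤ) xs ≡ 0ℤ
  wsum-0 []       = refl
  wsum-0 (x ∷ xs) = trans (ℤₚ.+-identityˡ _) (wsum-0 xs)

total-vanish : ∀ {w} b → (∀ {m λs} → Part b m λs → w λs ≡ 0ℤ) → total w b ≈ λ _ → 0ℤ
total-vanish b eq m = trans (total-cong b m eq) (total-0 b m)

total-cong-all : ∀ {w w′} b → (∀ λs → w λs ≡ w′ λs) → total w b ≈ total w′ b
total-cong-all b eq m = total-cong b m (λ {λs} _ → eq λs)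

total-top : ∀ {w w′} b → (∀ {m λs} → Part b m λs → w λs ≡ 0ℤ) → (∀ λs → w (suc b ∷ λs) ≡ w′ λs) →
            total w (suc b) ≈ shift (suc b) (total w′ (suc b))
total-top {w} {w′} b vanish eq m = begin
  total w (suc b) m ≡⟨ total-suc w b m ⟩
  total w b m + shift (suc b) (total (λ λs → w (suc b ∷ λs)) (suc b)) m
    ≡⟨ cong₂ _+_ (total-vanish b vanish m) (shift-cong (suc b) (total-cong-all (suc b) eq) m) ⟩
  0ℤ + shift (suc b) (total w′ (suc b)) m ≡⟨ ℤₚ.+-identityˡ _ ⟩
  shift (suc b) (total w′ (suc b)) m ∎

total-peel : ∀ {w w′} b → (∀ λs → w (suc b ∷ λs) ≡ w′ λs) →
             total w (suc b) ≈ total w b ⊕ shift (suc b) (total w′ (suc b))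
total-peel {w} b eq m = trans (total-suc w b m)
  (+-congˡ (total w b m) (shift-cong (suc b) (total-cong-all (suc b) eq) m))

containsAll-suc-vanish : ∀ {j m λs} → Part j m λs → containsAll (suc j) λs ≡ false
containsAll-suc-vanish {j} {λs = λs} part =
  trans (cong (containsAll j λs ∧_) (elemᵇ-> (ℕₚ.n<1+n j) (Part-≤ part))) (∧-zeroʳ _)

containsAll-suc-here : ∀ j λs → containsAll (suc j) (suc j ∷ λs) ≡ containsAll j λs
containsAll-suc-here j λs =
  trans (cong₂ _∧_ (containsAll-skip λs (ℕₚ.n<1+n j)) (elemᵇ-here (suc j) λs)) (∧-identityʳ _)

-- A size that does not affect the weight enters both sides by the same equation, g = A + q^{b+1} g,
-- which has only one solution.
shift-partsSeq-extend : ∀ {w} t b → (∀ λs → w (suc b ∷ λs) ≡ w λs) →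
                 total w b ≈ shift t (partsSeq b) → total w (suc b) ≈ shift t (partsSeq (suc b))
shift-partsSeq-extend {w} t b top eq m = IsSol-unique b {λ _ → shift t (partsSeq b)} (λ _ → lhs) (λ _ → rhs) 0 m
  where
  lhs : total w (suc b) ≈ shift t (partsSeq b) ⊕ shift (suc b) (total w (suc b))
  lhs m = trans (total-peel b top m) (cong₂ _+_ (eq m) refl)

  rhs : shift t (partsSeq (suc b)) ≈ shift t (partsSeq b) ⊕ shift (suc b) (shift t (partsSeq (suc b)))
  rhs m = begin
    shift t (partsSeq (suc b)) m                              ≡⟨ shift-cong t (total-suc _ b) m ⟩
    shift t (partsSeq b ⊕ shift (suc b) (partsSeq (suc b))) m        ≡⟨ shift-⊕ t (partsSeq b) _ m ⟩
    shift t (partsSeq b) m + shift t (shift (suc b) (partsSeq (suc b))) m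
      ≡⟨ +-congˡ (shift t (partsSeq b) m) (shift-comm t (suc b) (partsSeq (suc b)) m) ⟩
    shift t (partsSeq b) m + shift (suc b) (shift t (partsSeq (suc b))) m ∎

-- When `suc j` is the bound, one copy of it must be present and is removed; further copies stay
-- allowed, hence the appeal to `j` with `d = 1`. Larger sizes are then adjoined freely.
total-containsAll : ∀ j d → total (λ λs → ⟦ containsAll j λs ⟧) (d ℕ.+ j) ≈ shift (tri j) (partsSeq (d ℕ.+ j))
total-containsAll zero    d       m = refl
total-containsAll (suc j) zero    m = begin
  total (λ λs → ⟦ containsAll (suc j) λs ⟧) (suc j) m
    ≡⟨ total-top j (λ part → cong ⟦_⟧ (containsAll-suc-vanish part)) (λ λs → cong ⟦_⟧ (containsAll-suc-here j λs)) m ⟩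
  shift (suc j) (total (λ λs → ⟦ containsAll j λs ⟧) (suc j)) m
    ≡⟨ shift-cong (suc j) (total-containsAll j 1) m ⟩
  shift (suc j) (shift (tri j) (partsSeq (suc j))) m ≡⟨ shift-shift (suc j) (tri j) (partsSeq (suc j)) m ⟩
  shift (tri (suc j)) (partsSeq (suc j)) m ∎
total-containsAll (suc j) (suc d) = shift-partsSeq-extend (tri (suc j)) (d ℕ.+ suc j)
  (λ λs → cong ⟦_⟧ (containsAll-skip λs (s≤s (ℕₚ.m≤n+m (suc j) d))))
  (total-containsAll (suc j) d)

-- The generating function of M_k

countᵇ-true : ∀ Q {x} xs → Q x ≡ true → countᵇ Q (x ∷ xs) ≡ suc (countᵇ Q xs)
countᵇ-true Q {x} xs eq with Q x
... | true = refl

countᵇ-false : ∀ Q {x} xs → Q x ≡ false → countᵇ Q (x ∷ xs) ≡ countᵇ Q xs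
countᵇ-false Q {x} xs eq with Q x
... | false = refl

countᵇ-all : ∀ Q {xs} → All (λ x → Q x ≡ true) xs → countᵇ Q xs ≡ length xs
countᵇ-all Q []         = refl
countᵇ-all Q (_∷_ {xs = xs} eq eqs) = trans (countᵇ-true Q xs eq) (cong suc (countᵇ-all Q eqs))

countᵇ-none : ∀ Q {xs} → All (λ x → Q x ≡ false) xs → countᵇ Q xs ≡ 0
countᵇ-none Q []         = refl
countᵇ-none Q (_∷_ {xs = xs} eq eqs) = trans (countᵇ-false Q xs eq) (countᵇ-none Q eqs)

small : ℕ → ℕ → List ℕ → ℤ
small c t λs = ⟦ containsAll c λs ∧ (length λs <ᵇ t) ⟧

small-0 : ∀ c λs → small c 0 λs ≡ 0ℤ
small-0 c λs = cong ⟦_⟧ (∧-zeroʳ (containsAll c λs))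

mutual
  -- Removing one copy of each of 1, ..., c leaves fewer than t - c parts, all at most `c`, whence
  -- [t - 1, c]. In the induction, taking one copy of the top part leaves it allowed but no longer
  -- required, which is the situation of `total-small⁺`.
  total-small : ∀ c t → total (small c t) c ≈ shift (tri c) (qbin⁻ t c)
  total-small zero    zero    zero    = refl
  total-small zero    (suc t) zero    = refl
  total-small zero    zero    (suc m) = refl
  total-small zero    (suc t) (suc m) = refl
  total-small (suc c) zero    m       =
    trans (total-vanish (suc c) (λ {_} {λs} _ → small-0 (suc c) λs) m) (sym (shift-0 (tri (suc c)) m))
  total-small (suc c) (suc s) m       = begin
    total (small (suc c) (suc s)) (suc c) m
      ≡⟨ total-top c (λ part → cong (λ x → ⟦ x ∧ _ ⟧) (containsAll-suc-vanish part))
                     (λ λs → cong (λ x → ⟦ x ∧ (length λs <ᵇ s) ⟧) (containsAll-suc-here c λs)) m ⟩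
    shift (suc c) (total (small c s) (suc c)) m       ≡⟨ shift-cong (suc c) (total-small⁺ c s) m ⟩
    shift (suc c) (shift (tri c) (qbin s (suc c))) m     ≡⟨ shift-shift (suc c) (tri c) _ m ⟩
    shift (tri (suc c)) (qbin s (suc c)) m ∎

  -- Whether or not a part `c + 1` occurs gives the two terms of the q-Pascal rule.
  total-small⁺ : ∀ c s → total (small c s) (suc c) ≈ shift (tri c) (qbin s (suc c))
  total-small⁺ c zero    m =
    trans (total-vanish (suc c) (λ {_} {λs} _ → small-0 c λs) m) (sym (shift-0 (tri c) m))
  total-small⁺ c (suc r) m = begin
    total (small c (suc r)) (suc c) m
      ≡⟨ total-peel c (λ λs → cong (λ x → ⟦ x ∧ (length λs <ᵇ r) ⟧) (containsAll-skip λs (ℕₚ.n<1+n c))) m ⟩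
    total (small c (suc r)) c m + shift (suc c) (total (small c r) (suc c)) m
      ≡⟨ cong₂ _+_ (total-small c (suc r) m) (shift-cong (suc c) (total-small⁺ c r) m) ⟩
    shift (tri c) (qbin r c) m + shift (suc c) (shift (tri c) (qbin r (suc c))) m
      ≡⟨ +-congˡ (shift (tri c) (qbin r c) m) (shift-comm (suc c) (tri c) (qbin r (suc c)) m) ⟩
    shift (tri c) (qbin r c) m + shift (tri c) (shift (suc c) (qbin r (suc c))) m
      ≡⟨ shift-⊕ (tri c) (qbin r c) _ m ⟨
    shift (tri c) (qbin (suc r) (suc c)) m ∎

-- The offset `t` stands for parts exceeding `c + 1` that have already been removed; at `t = 0` this
-- is the condition counted by `Mℕ (suc c)`.
weight : ℕ → ℕ → List ℕ → ℤ
weight c t λs = ⟦ (containsAll c λs ∧ not (elemᵇ (suc c) λs))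
                ∧ (countᵇ (λ x → x <ᵇ suc c) λs <ᵇ t ℕ.+ countᵇ (λ x → suc c <ᵇ x) λs) ⟧

weight-∷ : ∀ c t {x} λs → suc c < x → weight c t (x ∷ λs) ≡ weight c (suc t) λs
weight-∷ c t {x} λs c<x = cong ⟦_⟧ (cong₂ _∧_
  (cong₂ (λ a b → a ∧ not b) (containsAll-skip λs (ℕₚ.<-trans (ℕₚ.n<1+n c) c<x)) (elemᵇ-there λs (ℕₚ.<⇒≢ c<x)))
  (cong₂ _<ᵇ_
    (countᵇ-false (λ x → x <ᵇ suc c) {x} λs (dec-false (x ℕₚ.<? suc c) (ℕₚ.<-asym c<x)))
    (trans (cong (t ℕ.+_) (countᵇ-true (λ x → suc c <ᵇ x) {x} λs (dec-true (suc c ℕₚ.<? x) c<x))) (ℕₚ.+-suc t _))))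

weight-here : ∀ c t λs → weight c t (suc c ∷ λs) ≡ 0ℤ
weight-here c t λs = cong (λ x → ⟦ x ∧ (countᵇ (λ x → x <ᵇ suc c) (suc c ∷ λs) <ᵇ t ℕ.+ countᵇ (λ x → suc c <ᵇ x) (suc c ∷ λs)) ⟧)
  (trans (cong (λ x → containsAll c (suc c ∷ λs) ∧ not x) (elemᵇ-here (suc c) λs)) (∧-zeroʳ _))

weight-small : ∀ c t {m λs} → Part c m λs → weight c t λs ≡ small c t λs
weight-small c t {λs = λs} part = cong ⟦_⟧ (cong₂ _∧_
  (trans (cong (λ x → containsAll c λs ∧ not x) (elemᵇ-> (ℕₚ.n<1+n c) λs≤c)) (∧-identityʳ _))
  (cong₂ _<ᵇ_
    (countᵇ-all (λ x → x <ᵇ suc c) (All.map (λ {x} x≤c → dec-true (x ℕₚ.<? suc c) (s≤s x≤c)) λs≤c))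
    (trans (cong (t ℕ.+_) (countᵇ-none (λ x → suc c <ᵇ x)
             (All.map (λ {x} x≤c → dec-false (suc c ℕₚ.<? x) (ℕₚ.≤⇒≯ (ℕₚ.m≤n⇒m≤1+n x≤c))) λs≤c)))
           (ℕₚ.+-identityʳ t))))
  where
  λs≤c : All (_≤ c) λs
  λs≤c = Part-≤ part

-- The part `c + 1` is excluded, so admitting it changes nothing. With no larger part left, the
-- comparison says that there are fewer than `t` parts.
total-weight-base : ∀ c t → total (weight c t) (suc c) ≈ shift (tri c) (qbin⁻ t c)
total-weight-base c t m = begin
  total (weight c t) (suc c) m ≡⟨ total-peel c (weight-here c t) m ⟩
  total (weight c t) c m + shift (suc c) (total (λ _ → 0ℤ) (suc c)) m
    ≡⟨ cong₂ _+_ (total-cong c m (weight-small c t))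
                 (trans (shift-cong (suc c) (total-0 (suc c)) m) (shift-0 (suc c) m)) ⟩
  total (small c t) c m + 0ℤ ≡⟨ ℤₚ.+-identityʳ _ ⟩
  total (small c t) c m      ≡⟨ total-small c t m ⟩
  shift (tri c) (qbin⁻ t c) m ∎

-- By `weight-∷`, removing a part larger than `c + 1` advances the offset, which is precisely the
-- recurrence solved by `Sol`.
total-weight : ∀ c d → (λ t → total (weight c t) (d ℕ.+ suc c)) ≋ AddParts (suc c) d (λ t → shift (tri c) (qbin⁻ t c))
total-weight c zero    t m = total-weight-base c t m
total-weight c (suc d) t m = trans (Sol-unique b sol t m)
  (trans (cong (λ a → Sol a (λ t → total (weight c t) b) t m) (ℕₚ.+-comm d (suc c)))
         (Sol-cong (suc c ℕ.+ d) (total-weight c d) t m))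
  where
  b : ℕ
  b = d ℕ.+ suc c

  sol : IsSol b (λ t → total (weight c t) b) (λ t → total (weight c t) (suc b))
  sol t m = total-peel b (λ λs → weight-∷ c t λs (s≤s (ℕₚ.m≤n+m (suc c) d))) m

wsum-⟦⟧ : ∀ Q xs → + length (filterᵇ Q xs) ≡ wsum (λ λs → ⟦ Q λs ⟧) xs
wsum-⟦⟧ Q []       = refl
wsum-⟦⟧ Q (x ∷ xs) with Q x
... | true  = trans (ℤₚ.pos-+ 1 _) (+-congˡ 1ℤ (wsum-⟦⟧ Q xs))
... | false = trans (wsum-⟦⟧ Q xs) (sym (ℤₚ.+-identityˡ _))

Mℕ-AddParts∞ : ∀ c m → + Mℕ (suc c) m ≡ shift (tri c) (AddParts∞ (suc c) (λ t → qbin⁻ t c) 0) m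
Mℕ-AddParts∞ c m = begin
  + Mℕ (suc c) m ≡⟨ wsum-⟦⟧ _ (partitions m) ⟩
  total (λ λs → ⟦ (mex λs ≡ᵇ suc c) ∧ (countᵇ (λ x → x <ᵇ suc c) λs <ᵇ countᵇ (λ x → suc c <ᵇ x) λs) ⟧) m m
    ≡⟨ total-cong-all m (λ λs → cong (λ x → ⟦ x ∧ (countᵇ (λ x → x <ᵇ suc c) λs <ᵇ countᵇ (λ x → suc c <ᵇ x) λs) ⟧) (mex≡ᵇ c λs)) m ⟩
  total (weight c 0) m m                          ≡⟨ total-stable (weight c 0) (ℕₚ.≤⇒≤′ (ℕₚ.m≤m+n m (suc c))) ⟨
  total (weight c 0) (m ℕ.+ suc c) m              ≡⟨ total-weight c m 0 m ⟩
  AddParts∞ (suc c) (λ t → shift (tri c) (qbin⁻ t c)) 0 m    ≡⟨ AddParts∞-shift (suc c) (tri c) (λ t → qbin⁻ t c) 0 m ⟩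
  shift (tri c) (AddParts∞ (suc c) (λ t → qbin⁻ t c) 0) m ∎

-- The truncated pentagonal number theorem

-- The series Σ_N q^{(k+1)N}/(q)_N [N, i].
qbinSum : ℕ → ℕ → Seq
qbinSum i k = AddParts∞ k (λ t → qbin t i) 0

-- The series 1/(q)_i times the product of 1/(1 - q^n) over n > k.
partsSum : ℕ → ℕ → Seq
partsSum i k = AddParts∞ k (λ _ → partsSeq i) 0

partsSum-suc : ∀ i k → partsSum (suc i) k ≈ partsSum i k ⊕ shift (suc i) (partsSum (suc i) k)
partsSum-suc i k m = begin
  partsSum (suc i) k m ≡⟨ AddParts∞-cong k (λ _ → total-suc _ i) 0 m ⟩
  AddParts∞ k (λ _ → partsSeq i ⊕ shift (suc i) (partsSeq (suc i))) 0 m ≡⟨ AddParts∞-⊕ k _ _ 0 m ⟩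
  partsSum i k m + AddParts∞ k (λ _ → shift (suc i) (partsSeq (suc i))) 0 m ≡⟨ +-congˡ (partsSum i k m) (AddParts∞-shift k (suc i) _ 0 m) ⟩
  partsSum i k m + shift (suc i) (partsSum (suc i) k) m ∎

partsSum-bottom : ∀ i k → partsSum i k ≈ partsSum i (suc k) ⊕ shift (suc k) (partsSum i k)
partsSum-bottom i k = AddParts∞-bottom k (λ _ → partsSeq i) 0

AddParts-partsSeq : ∀ k d → AddParts k d (λ _ → partsSeq k) ≋ λ _ → partsSeq (k ℕ.+ d)
AddParts-partsSeq k zero    t m = cong (λ b → partsSeq b m) (sym (ℕₚ.+-identityʳ k))
AddParts-partsSeq k (suc d) t m = begin
  Sol (k ℕ.+ d) (AddParts k d (λ _ → partsSeq k)) t m  ≡⟨ Sol-cong (k ℕ.+ d) (AddParts-partsSeq k d) t m ⟩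
  Sol (k ℕ.+ d) (λ _ → partsSeq (k ℕ.+ d)) t m  ≡⟨ Sol-unique (k ℕ.+ d) (λ _ → total-suc _ (k ℕ.+ d)) t m ⟨
  partsSeq (suc (k ℕ.+ d)) m                    ≡⟨ cong (λ b → partsSeq b m) (ℕₚ.+-suc k d) ⟨
  partsSeq (k ℕ.+ suc d) m ∎

partsSum-diagonal : ∀ k → partsSum k k ≈ partitionSeq
partsSum-diagonal k m = trans (AddParts-partsSeq k m 0 m) (total-stable _ (ℕₚ.≤⇒≤′ (ℕₚ.m≤n+m m k)))

one≈partsSeq : one ≈ partsSeq 0
one≈partsSeq zero    = refl
one≈partsSeq (suc m) = refl

-- Splitting off a part `k + 1`, if there is one, advances the offset, and the q-Pascal rule then
-- expands [t + 1, i + 1].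
qbinSum-suc : ∀ i k → qbinSum (suc i) k ≈ shift (suc k) (qbinSum i k) ⊕ qbinSum (suc i) (suc k) ⊕ shift (suc (k ℕ.+ suc i)) (qbinSum (suc i) k)
qbinSum-suc i k m = begin
  qbinSum (suc i) k m ≡⟨ AddParts∞-bottom k (λ t → qbin t (suc i)) 0 m ⟩
  y + shift (suc k) (AddParts∞ k (λ t → qbin t i ⊕ shift (suc i) (qbin t (suc i))) 0) m
    ≡⟨ +-congˡ y (shift-cong (suc k) (AddParts∞-⊕ k _ _ 0) m) ⟩
  y + shift (suc k) (qbinSum i k ⊕ AddParts∞ k (λ t → shift (suc i) (qbin t (suc i))) 0) m
    ≡⟨ +-congˡ y (shift-⊕ (suc k) (qbinSum i k) _ m) ⟩
  y + (x + shift (suc k) (AddParts∞ k (λ t → shift (suc i) (qbin t (suc i))) 0) m)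
    ≡⟨ +-congˡ y (+-congˡ x (shift-cong (suc k) (AddParts∞-shift k (suc i) _ 0) m)) ⟩
  y + (x + shift (suc k) (shift (suc i) (qbinSum (suc i) k)) m)
    ≡⟨ +-congˡ y (+-congˡ x (shift-shift (suc k) (suc i) (qbinSum (suc i) k) m)) ⟩
  y + (x + shift (suc (k ℕ.+ suc i)) (qbinSum (suc i) k) m)
    ≡⟨ rearrange x y _ ⟩
  x + y + shift (suc (k ℕ.+ suc i)) (qbinSum (suc i) k) m ∎
  where
  x y : ℤ
  x = shift (suc k) (qbinSum i k) m
  y = qbinSum (suc i) (suc k) m

  rearrange : ∀ x y z → y + (x + z) ≡ x + y + z
  rearrange = solve-∀

-- The coefficient at m is reached by increasing k until k ≥ m.
descent-unique : ∀ a {A X Y : Family} →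
  (∀ k → X k ≈ A k ⊕ X (suc k) ⊕ shift (suc (k ℕ.+ a)) (X k)) →
  (∀ k → Y k ≈ A k ⊕ Y (suc k) ⊕ shift (suc (k ℕ.+ a)) (Y k)) →
  (∀ k m → m ≤ k → X k m ≡ Y k m) → X ≋ Y
descent-unique a {A} {X} {Y} X-rec Y-rec small k m = below (suc m) m k m ℕₚ.≤-refl (ℕₚ.m≤m+n m k)
  where
  below : ∀ n d k m → m < n → m ≤ d ℕ.+ k → X k m ≡ Y k m
  below n       zero    k m m<n       m≤k   = small k m m≤k
  -- Raising `k` uses up `d`. In the shifted term the degree drops to some `j` below `m`, so the
  -- distance may restart at `j`.
  below (suc n) (suc d) k m (s≤s m≤n) m≤d+k = begin
    X k m ≡⟨ X-rec k m ⟩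
    A k m + X (suc k) m + shift (suc (k ℕ.+ a)) (X k) m
      ≡⟨ cong₂ _+_ (+-congˡ (A k m) (below (suc n) d (suc k) m (s≤s m≤n) (subst (m ≤_) (sym (ℕₚ.+-suc d k)) m≤d+k)))
                   (shift-cong-< (k ℕ.+ a) m (λ j j<m → below n j k j (ℕₚ.≤-trans j<m m≤n) (ℕₚ.m≤m+n j k))) ⟩
    A k m + Y (suc k) m + shift (suc (k ℕ.+ a)) (Y k) m ≡⟨ Y-rec k m ⟨
    Y k m ∎

-- With z = q^{k+1} this is Σ_N z^N/(q)_N [N, i] = z^i/((q)_i (z)_∞), usually read off from
-- [N, i]/(q)_N = 1/((q)_i (q)_{N-i}). To avoid products, both sides are shown to satisfy one
-- recurrence in `k`.
qbinSum≈partsSum : ∀ i k → qbinSum i k ≈ shift (i * suc k) (partsSum i k)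
qbinSum≈partsSum zero    k m = AddParts∞-cong k (λ _ → one≈partsSeq) 0 m
qbinSum≈partsSum (suc i) k m = descent-unique (suc i) {λ k → shift (suc k) (qbinSum i k)} (qbinSum-suc i) Y-rec qbinSum-small k m
  where
  Y : Family
  Y k = shift (suc i * suc k) (partsSum (suc i) k)

  qbinSum-small : ∀ k m → m ≤ k → qbinSum (suc i) k m ≡ Y k m
  -- In degrees up to `k` no part can be adjoined, which leaves `qbin 0 (suc i)`, the zero series;
  -- the other side starts beyond degree `k`.
  qbinSum-small k m m≤k = trans (AddParts∞-small k (λ t → qbin t (suc i)) 0 m m≤k)
    (sym (shift-> (suc i * suc k) (partsSum (suc i) k) m (ℕₚ.≤-trans (s≤s m≤k) (ℕₚ.m≤m+n (suc k) (i * suc k)))))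

  -- A part `i + 1` is split off first, and then, from the term where that happened, a part `k + 1`.
  Y-rec : ∀ k → Y k ≈ shift (suc k) (qbinSum i k) ⊕ Y (suc k) ⊕ shift (suc (k ℕ.+ suc i)) (Y k)
  Y-rec k m = begin
    shift e z m ≡⟨ shift-cong e (partsSum-suc i k) m ⟩
    shift e (partsSum i k ⊕ shift (suc i) z) m ≡⟨ shift-⊕ e (partsSum i k) _ m ⟩
    shift e (partsSum i k) m + shift e (shift (suc i) z) m
      ≡⟨ cong₂ _+_ first (trans (shift-shift e (suc i) z m) (shift-cong (e ℕ.+ suc i) (partsSum-bottom (suc i) k) m)) ⟩
    shift (suc k) (qbinSum i k) m + shift (e ℕ.+ suc i) (partsSum (suc i) (suc k) ⊕ shift (suc k) z) m
      ≡⟨ +-congˡ (shift (suc k) (qbinSum i k) m) (shift-⊕ (e ℕ.+ suc i) (partsSum (suc i) (suc k)) _ m) ⟩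
    shift (suc k) (qbinSum i k) m + (shift (e ℕ.+ suc i) (partsSum (suc i) (suc k)) m + shift (e ℕ.+ suc i) (shift (suc k) z) m)
      ≡⟨ ℤₚ.+-assoc (shift (suc k) (qbinSum i k) m) _ _ ⟨
    shift (suc k) (qbinSum i k) m + shift (e ℕ.+ suc i) (partsSum (suc i) (suc k)) m + shift (e ℕ.+ suc i) (shift (suc k) z) m
      ≡⟨ cong₂ _+_ (+-congˡ (shift (suc k) (qbinSum i k) m) (cong (λ a → shift a (partsSum (suc i) (suc k)) m) (exponent₁ i k))) last ⟩
    shift (suc k) (qbinSum i k) m + Y (suc k) m + shift (suc (k ℕ.+ suc i)) (Y k) m ∎
    where
    e : ℕ
    e = suc i * suc k

    z : Seq
    z = partsSum (suc i) k

    first : shift e (partsSum i k) m ≡ shift (suc k) (qbinSum i k) m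
    first = begin
      shift e (partsSum i k) m                             ≡⟨ shift-shift (suc k) (i * suc k) (partsSum i k) m ⟨
      shift (suc k) (shift (i * suc k) (partsSum i k)) m   ≡⟨ shift-cong (suc k) (qbinSum≈partsSum i k) m ⟨
      shift (suc k) (qbinSum i k) m ∎

    exponent₁ : ∀ i k → suc i * suc k ℕ.+ suc i ≡ suc i * suc (suc k)
    exponent₁ = ℕ-Ring.solve-∀

    exponent₂ : ∀ e i k → e ℕ.+ suc i ℕ.+ suc k ≡ suc (k ℕ.+ suc i) ℕ.+ e
    exponent₂ = ℕ-Ring.solve-∀

    last : shift (e ℕ.+ suc i) (shift (suc k) z) m ≡ shift (suc (k ℕ.+ suc i)) (Y k) m
    last = begin
      shift (e ℕ.+ suc i) (shift (suc k) z) m     ≡⟨ shift-shift (e ℕ.+ suc i) (suc k) z m ⟩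
      shift (e ℕ.+ suc i ℕ.+ suc k) z m           ≡⟨ cong (λ a → shift a z m) (exponent₂ e i k) ⟩
      shift (suc (k ℕ.+ suc i) ℕ.+ e) z m         ≡⟨ shift-shift (suc (k ℕ.+ suc i)) e z m ⟨
      shift (suc (k ℕ.+ suc i)) (Y k) m ∎

qbinSum-diagonal : ∀ k → qbinSum k k ≈ shift (k * suc k) partitionSeq
qbinSum-diagonal k m = trans (qbinSum≈partsSum k k m) (shift-cong (k * suc k) (partsSum-diagonal k) m)

-- The value at 0 makes `𝓜-suc` hold from `k = 0` on, and `triSum` turns it into `δ`.
𝓜 : ℕ → Seq
𝓜 zero    = one
𝓜 (suc c) m = + Mℕ (suc c) m

-- The pentagonal number k(3k+1)/2.
ω : ℕ → ℕ
ω zero    = 0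
ω (suc c) = tri c ℕ.+ suc c * suc (suc c)

-- The zero values of `qbin⁻` at offset 0 let the rule hold for every `t`.
qbin-pascal : ∀ t i → qbin t (suc i) ≈ qbin⁻ t i ⊕ shift (suc i) (qbin⁻ t (suc i))
qbin-pascal zero    i m = sym (trans (ℤₚ.+-identityˡ _) (shift-0 (suc i) m))
qbin-pascal (suc t) i m = refl

𝓜-suc : ∀ k → 𝓜 k ⊕ 𝓜 (suc k) ⊕ shift (ω k ℕ.+ suc (k ℕ.+ k)) partitionSeq ≈ shift (ω k) partitionSeq
𝓜-suc zero m = begin
  one m + + Mℕ 1 m + shift 1 partitionSeq m
    ≡⟨ cong₂ _+_ (cong₂ _+_ (sym (only-head m)) (Mℕ-AddParts∞ 0 m)) (sym (shift-cong 1 (qbinSum-diagonal 0) m)) ⟩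
  AddParts∞ 1 D₀ 0 m + AddParts∞ 1 (λ t → qbin⁻ t 0) 0 m + shift 1 (qbinSum 0 0) m
    ≡⟨ cong₂ _+_ (AddParts∞-⊕ 1 D₀ (λ t → qbin⁻ t 0) 0 m) refl ⟨
  AddParts∞ 1 (λ t → D₀ t ⊕ qbin⁻ t 0) 0 m + shift 1 (qbinSum 0 0) m
    ≡⟨ cong₂ _+_ (AddParts∞-cong 1 {F = λ t → D₀ t ⊕ qbin⁻ t 0} {G = λ t → qbin t 0} split 0 m) refl ⟩
  AddParts∞ 1 (λ t → qbin t 0) 0 m + shift 1 (qbinSum 0 0) m ≡⟨ AddParts∞-bottom 0 (λ t → qbin t 0) 0 m ⟨
  qbinSum 0 0 m                                    ≡⟨ qbinSum-diagonal 0 m ⟩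
  partitionSeq m ∎
  where
  -- `D₀` supplies the term that `qbin⁻ t 0` lacks at offset 0. It counts the empty partition only,
  -- which accounts for `𝓜 0`.
  D₀ : Family
  D₀ zero    = one
  D₀ (suc t) = λ _ → 0ℤ

  only-head : AddParts∞ 1 D₀ 0 ≈ one
  only-head m = proj₁ (AddParts-single 1 m D₀ (λ _ _ → refl)) m

  split : (λ t → D₀ t ⊕ qbin⁻ t 0) ≋ (λ t → qbin t 0)
  split zero    m = ℤₚ.+-identityʳ _
  split (suc t) m = ℤₚ.+-identityˡ _
𝓜-suc k@(suc c) m = begin
  + Mℕ k m + + Mℕ (suc k) m + shift (ω k ℕ.+ suc (k ℕ.+ k)) partitionSeq m
    ≡⟨ cong₂ _+_ (cong₂ _+_ (Mℕ-AddParts∞ c m) (Mℕ-AddParts∞ k m)) (cong (λ a → shift a partitionSeq m) (exponent (tri c) (k * suc k) k)) ⟩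
  shift (tri c) x m + shift (tri k) y m + shift (tri k ℕ.+ (suc k ℕ.+ k * suc k)) partitionSeq m
    ≡⟨ +-congˡ (shift (tri c) x m + shift (tri k) y m) (begin
         shift (tri k ℕ.+ (suc k ℕ.+ k * suc k)) partitionSeq m     ≡⟨ shift-shift (tri k) (suc k ℕ.+ k * suc k) partitionSeq m ⟨
         shift (tri k) (shift (suc k ℕ.+ k * suc k) partitionSeq) m ≡⟨ shift-cong (tri k) (λ m → trans (shift-cong (suc k) (qbinSum-diagonal k) m) (shift-shift (suc k) (k * suc k) partitionSeq m)) m ⟨
         shift (tri k) (shift (suc k) (qbinSum k k)) m ∎) ⟩
  shift (tri c) x m + shift (tri k) y m + shift (tri k) (shift (suc k) (qbinSum k k)) m
    ≡⟨ ℤₚ.+-assoc (shift (tri c) x m) _ _ ⟩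
  shift (tri c) x m + (shift (tri k) y m + shift (tri k) (shift (suc k) (qbinSum k k)) m)
    ≡⟨ +-congˡ (shift (tri c) x m) (begin
         shift (tri k) y m + shift (tri k) (shift (suc k) (qbinSum k k)) m ≡⟨ shift-⊕ (tri k) y _ m ⟨
         -- Advancing the offset turns `qbin⁻ t k` into `qbin t k`, so the partitions with a part
         -- `k + 1` are the ones in `qbinSum k k`.
         shift (tri k) (y ⊕ shift (suc k) (qbinSum k k)) m                 ≡⟨ shift-cong (tri k) (AddParts∞-bottom k (λ t → qbin⁻ t k) 0) m ⟨
         shift (tri k) w m                                           ≡⟨ shift-shift k (tri c) w m ⟨
         shift k (shift (tri c) w) m                                 ≡⟨ shift-comm k (tri c) w m ⟩
         shift (tri c) (shift k w) m ∎) ⟩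
  shift (tri c) x m + shift (tri c) (shift k w) m ≡⟨ shift-⊕ (tri c) x _ m ⟨
  shift (tri c) (x ⊕ shift k w) m                 ≡⟨ shift-cong (tri c) qbinSum-split m ⟨
  shift (tri c) (qbinSum k k) m                         ≡⟨ shift-cong (tri c) (qbinSum-diagonal k) m ⟩
  shift (tri c) (shift (k * suc k) partitionSeq) m           ≡⟨ shift-shift (tri c) (k * suc k) partitionSeq m ⟩
  shift (ω k) partitionSeq m ∎
  where
  x y w : Seq
  x = AddParts∞ k (λ t → qbin⁻ t c) 0
  y = AddParts∞ (suc k) (λ t → qbin⁻ t k) 0
  w = AddParts∞ k (λ t → qbin⁻ t k) 0

  exponent : ∀ a b k → a ℕ.+ b ℕ.+ suc (k ℕ.+ k) ≡ k ℕ.+ a ℕ.+ (suc k ℕ.+ b)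
  exponent = ℕ-Ring.solve-∀

  qbinSum-split : qbinSum k k ≈ x ⊕ shift k w
  qbinSum-split m = begin
    qbinSum k k m ≡⟨ AddParts∞-cong k (λ t → qbin-pascal t c) 0 m ⟩
    AddParts∞ k (λ t → qbin⁻ t c ⊕ shift k (qbin⁻ t k)) 0 m ≡⟨ AddParts∞-⊕ k _ _ 0 m ⟩
    x m + AddParts∞ k (λ t → shift k (qbin⁻ t k)) 0 m ≡⟨ +-congˡ (x m) (AddParts∞-shift k k _ 0 m) ⟩
    x m + shift k w m ∎

Σℕ-cong : ∀ N {f g} → (∀ j → j < N → f j ≡ g j) → Σℕ N f ≡ Σℕ N g
Σℕ-cong zero    eq = refl
Σℕ-cong (suc N) eq = cong₂ _+_ (Σℕ-cong N (λ j j<N → eq j (ℕₚ.m<n⇒m<1+n j<N))) (eq N (ℕₚ.n<1+n N))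

Σℕ-+ : ∀ N f g → Σℕ N (λ j → f j + g j) ≡ Σℕ N f + Σℕ N g
Σℕ-+ zero    f g = refl
Σℕ-+ (suc N) f g = trans (cong₂ _+_ (Σℕ-+ N f g) refl) (interchange (Σℕ N f) (Σℕ N g) (f N) (g N))

shift-Σℕ : ∀ a N (f : ℕ → Seq) → shift a (λ m → Σℕ N (λ j → f j m)) ≈ λ m → Σℕ N (λ j → shift a (f j) m)
shift-Σℕ a zero    f m = shift-0 a m
shift-Σℕ a (suc N) f m = trans (shift-⊕ a (λ m → Σℕ N (λ j → f j m)) (f N) m)
  (cong₂ _+_ (shift-Σℕ a N f m) refl)

wsum-+ : ∀ v w xs → wsum (λ λs → v λs + w λs) xs ≡ wsum v xs + wsum w xs
wsum-+ v w []       = refl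
wsum-+ v w (x ∷ xs) = trans (+-congˡ (v x + w x) (wsum-+ v w xs)) (interchange (v x) (w x) (wsum v xs) (wsum w xs))

total-Σℕ : ∀ N (w : ℕ → List ℕ → ℤ) b m → total (λ λs → Σℕ N (λ j → w j λs)) b m ≡ Σℕ N (λ j → total (w j) b m)
total-Σℕ zero    w b m = total-0 b m
total-Σℕ (suc N) w b m = trans (wsum-+ (λ λs → Σℕ N (λ j → w j λs)) (w N) (partsLE b m))
  (cong₂ _+_ (total-Σℕ N w b m) refl)

-- Summation over shifts by triangular numbers

-- Terms with j > m vanish at degree `m`, because T_j ≥ j.
triSum : Seq → Seq
triSum f m = Σℕ (suc m) (λ j → shift (tri j) f m)

n≤tri : ∀ n → n ≤ tri n
n≤tri zero    = z≤n
n≤tri (suc n) = ℕₚ.m≤m+n (suc n) (tri n)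

triSum-stable : ∀ f {m N} → m ≤′ N → Σℕ (suc N) (λ j → shift (tri j) f m) ≡ triSum f m
triSum-stable f             ≤′-refl       = refl
triSum-stable f {m} {suc N} (≤′-step m≤N) = trans
  (cong₂ _+_ (triSum-stable f m≤N) (shift-> (tri (suc N)) f m (ℕₚ.≤-trans (s≤s (ℕₚ.≤′⇒≤ m≤N)) (n≤tri (suc N)))))
  (ℤₚ.+-identityʳ _)

triSum-cong : ∀ {f g} → f ≈ g → triSum f ≈ triSum g
triSum-cong eq m = Σℕ-cong (suc m) (λ j _ → shift-cong (tri j) eq m)

triSum-⊕ : ∀ f g → triSum (f ⊕ g) ≈ triSum f ⊕ triSum g
triSum-⊕ f g m = trans (Σℕ-cong (suc m) (λ j _ → shift-⊕ (tri j) f g m)) (Σℕ-+ (suc m) _ _)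

triSum-shift : ∀ a f → triSum (shift a f) ≈ shift a (triSum f)
triSum-shift a f m = begin
  Σℕ (suc m) (λ j → shift (tri j) (shift a f) m)   ≡⟨ Σℕ-cong (suc m) (λ j _ → shift-comm (tri j) a f m) ⟩
  Σℕ (suc m) (λ j → shift a (shift (tri j) f) m)   ≡⟨ shift-Σℕ a (suc m) (λ j → shift (tri j) f) m ⟨
  shift a (λ i → Σℕ (suc m) (λ j → shift (tri j) f i)) m
    ≡⟨ shift-cong-≤ a m (λ i i≤m → triSum-stable f (ℕₚ.≤⇒≤′ i≤m)) ⟩
  -- truncated
  shift a (triSum f) m ∎

Σℕ-<ᵇ : ∀ N c → Σℕ N (λ j → ⟦ j <ᵇ c ⟧) ≡ + (N ℕ.⊓ c)
Σℕ-<ᵇ zero    c = refl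
Σℕ-<ᵇ (suc N) c with N ℕₚ.<? c
... | yes N<c = begin
  Σℕ N (λ j → ⟦ j <ᵇ c ⟧) + ⟦ N <ᵇ c ⟧ ≡⟨ cong₂ (λ x b → x + ⟦ b ⟧) (Σℕ-<ᵇ N c) (dec-true (N ℕₚ.<? c) N<c) ⟩
  + (N ℕ.⊓ c ℕ.+ 1)                    ≡⟨ cong (λ x → + (x ℕ.+ 1)) (ℕₚ.m≤n⇒m⊓n≡m (ℕₚ.<⇒≤ N<c)) ⟩
  + (N ℕ.+ 1)                          ≡⟨ cong +_ (ℕₚ.+-comm N 1) ⟩
  + suc N                              ≡⟨ cong +_ (ℕₚ.m≤n⇒m⊓n≡m N<c) ⟨
  + (suc N ℕ.⊓ c) ∎
... | no  N≮c = begin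
  Σℕ N (λ j → ⟦ j <ᵇ c ⟧) + ⟦ N <ᵇ c ⟧ ≡⟨ cong₂ (λ x b → x + ⟦ b ⟧) (Σℕ-<ᵇ N c) (dec-false (N ℕₚ.<? c) N≮c) ⟩
  + (N ℕ.⊓ c) + 0ℤ                     ≡⟨ ℤₚ.+-identityʳ _ ⟩
  + (N ℕ.⊓ c)                          ≡⟨ cong +_ (ℕₚ.m≥n⇒m⊓n≡n (ℕₚ.≮⇒≥ N≮c)) ⟩
  + c                                  ≡⟨ cong +_ (ℕₚ.m≥n⇒m⊓n≡n (ℕₚ.m≤n⇒m≤1+n (ℕₚ.≮⇒≥ N≮c))) ⟨
  + (suc N ℕ.⊓ c) ∎

mex≤ : ∀ {b m λs} → Part b m λs → mex λs ≤ suc m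
mex≤ {m = m} {λs} part with mex-spec λs
... | c , is-mex = subst (_≤ suc m) (sym mex≡suc)
  (s≤s (ℕₚ.≤-trans (containsAll⇒≤length c λs all) (Part-length part)))
  where open IsMex is-mex

-- The cutoff `suc m` is large enough, since a partition of `m` has at most `m` parts and hence mex
-- at most `m + 1`.
mex-Σℕ : ∀ {b m λs} → Part b m λs → + mex λs ≡ Σℕ (suc m) (λ j → ⟦ containsAll j λs ⟧)
mex-Σℕ {m = m} {λs} part = begin
  + mex λs                                  ≡⟨ cong +_ (ℕₚ.m≥n⇒m⊓n≡n (mex≤ part)) ⟨
  + (suc m ℕ.⊓ mex λs)                      ≡⟨ Σℕ-<ᵇ (suc m) (mex λs) ⟨
  Σℕ (suc m) (λ j → ⟦ j <ᵇ mex λs ⟧)        ≡⟨ Σℕ-cong (suc m) (λ j _ → cong ⟦_⟧ (containsAll≡<ᵇmex j λs)) ⟨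
  Σℕ (suc m) (λ j → ⟦ containsAll j λs ⟧) ∎

sum-wsum : ∀ f xs → + sum (map f xs) ≡ wsum (λ λs → + f λs) xs
sum-wsum f []       = refl
sum-wsum f (x ∷ xs) = +-congˡ (+ f x) (sum-wsum f xs)

σmexℕ-triSum : ∀ m → + σmexℕ m ≡ triSum partitionSeq m
σmexℕ-triSum m = begin
  + σmexℕ m                                                 ≡⟨ sum-wsum mex (partitions m) ⟩
  total (λ λs → + mex λs) m m                               ≡⟨ total-cong m m mex-Σℕ ⟩
  total (λ λs → Σℕ (suc m) (λ j → ⟦ containsAll j λs ⟧)) m m ≡⟨ total-Σℕ (suc m) (λ j λs → ⟦ containsAll j λs ⟧) m m ⟩
  Σℕ (suc m) (λ j → total (λ λs → ⟦ containsAll j λs ⟧) m m) ≡⟨ Σℕ-cong (suc m) (λ j j<1+m → term j (ℕ.s≤s⁻¹ j<1+m)) ⟩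
  triSum partitionSeq m ∎
  where
  term : ∀ j → j ≤ m → total (λ λs → ⟦ containsAll j λs ⟧) m m ≡ shift (tri j) partitionSeq m
  term j j≤m = begin
    total (λ λs → ⟦ containsAll j λs ⟧) m m
      ≡⟨ subst (λ b → total (λ λs → ⟦ containsAll j λs ⟧) b m ≡ shift (tri j) (partsSeq b) m)
               (ℕₚ.m∸n+n≡m j≤m) (total-containsAll j (m ∸ j) m) ⟩
    shift (tri j) (partsSeq m) m ≡⟨ shift-cong-≤ (tri j) m (λ i i≤m → total-stable _ (ℕₚ.≤⇒≤′ i≤m)) ⟩
    shift (tri j) partitionSeq m ∎

-- The indicator of triangular numbers

tri*2 : ∀ j → tri j * 2 ≡ j * suc j
tri*2 zero    = refl
tri*2 (suc j) = begin
  (suc j ℕ.+ tri j) * 2        ≡⟨ ℕₚ.*-distribʳ-+ 2 (suc j) (tri j) ⟩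
  suc j * 2 ℕ.+ tri j * 2      ≡⟨ cong (suc j * 2 ℕ.+_) (tri*2 j) ⟩
  suc j * 2 ℕ.+ j * suc j      ≡⟨ rearrange j ⟩
  suc j * suc (suc j) ∎
  where
  rearrange : ∀ j → suc j * 2 ℕ.+ j * suc j ≡ suc j * suc (suc j)
  rearrange = ℕ-Ring.solve-∀

shift-one : ∀ a m → shift a one m ≡ ⟦ a ≡ᵇ m ⟧
shift-one zero    zero    = refl
shift-one zero    (suc m) = refl
shift-one (suc a) zero    = refl
shift-one (suc a) (suc m) = shift-one a m

triangular : ℕ → ℕ → Bool
triangular n j = j * suc j ≡ᵇ 2 * n

triangular≡ : ∀ n j → (tri j ≡ᵇ n) ≡ triangular n j
triangular≡ n j with tri j ℕₚ.≟ n
... | yes eq  = trans (dec-true (tri j ℕₚ.≟ n) eq) (sym (dec-true (j * suc j ℕₚ.≟ 2 * n)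
                  (trans (sym (tri*2 j)) (trans (ℕₚ.*-comm (tri j) 2) (cong (2 *_) eq)))))
... | no  neq = trans (dec-false (tri j ℕₚ.≟ n) neq) (sym (dec-false (j * suc j ℕₚ.≟ 2 * n)
                  (λ eq → neq (ℕₚ.*-cancelˡ-≡ (tri j) n 2 (trans (ℕₚ.*-comm 2 (tri j)) (trans (tri*2 j) eq))))))

triangular-unique : ∀ n {i j} → i < j → triangular n j ≡ true → triangular n i ≡ false
triangular-unique n {i} {j} i<j eq = dec-false (i * suc i ℕₚ.≟ 2 * n)
  (λ eq′ → ℕₚ.<⇒≢ (ℕₚ.*-mono-< i<j (s≤s i<j)) (trans eq′ (sym (ℕₚ.≡ᵇ⇒≡ _ _ (subst T (sym eq) tt)))))

anyBelow : (ℕ → Bool) → ℕ → Bool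
anyBelow h N = foldr (λ m b → h m ∨ b) false (upTo N)

foldr-∨ : ∀ (h : ℕ → Bool) xs x → foldr (λ m b → h m ∨ b) false (xs ++ x ∷ []) ≡ foldr (λ m b → h m ∨ b) false xs ∨ h x
foldr-∨ h []       x = ∨-identityʳ (h x)
foldr-∨ h (y ∷ xs) x with h y
... | true  = refl
... | false = foldr-∨ h xs x

anyBelow-suc : ∀ h N → anyBelow h (suc N) ≡ anyBelow h N ∨ h N
anyBelow-suc h N = trans (cong (foldr (λ m b → h m ∨ b) false) (sym (Listₚ.upTo-∷ʳ N))) (foldr-∨ h (upTo N) N)

anyBelow-none : ∀ h N → (∀ j → j < N → h j ≡ false) → anyBelow h N ≡ false
anyBelow-none h zero    none = refl
anyBelow-none h (suc N) none = trans (anyBelow-suc h N)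
  (cong₂ _∨_ (anyBelow-none h N (λ j j<N → none j (ℕₚ.m<n⇒m<1+n j<N))) (none N (ℕₚ.n<1+n N)))

-- At most one index satisfies `h`, so counting the indices and asking whether there is one give the
-- same value.
anyBelow-Σℕ : ∀ h → (∀ {i j} → i < j → h j ≡ true → h i ≡ false) → ∀ N → Σℕ N (λ j → ⟦ h j ⟧) ≡ ⟦ anyBelow h N ⟧
anyBelow-Σℕ h unique zero    = refl
anyBelow-Σℕ h unique (suc N) = begin
  Σℕ N (λ j → ⟦ h j ⟧) + ⟦ h N ⟧ ≡⟨ cong (_+ ⟦ h N ⟧) (anyBelow-Σℕ h unique N) ⟩
  ⟦ anyBelow h N ⟧ + ⟦ h N ⟧     ≡⟨ disjoint ⟩
  ⟦ anyBelow h N ∨ h N ⟧         ≡⟨ cong ⟦_⟧ (anyBelow-suc h N) ⟨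
  ⟦ anyBelow h (suc N) ⟧ ∎
  where
  disjoint : ⟦ anyBelow h N ⟧ + ⟦ h N ⟧ ≡ ⟦ anyBelow h N ∨ h N ⟧
  disjoint with h N in hN
  ... | true  = trans (cong (λ b → ⟦ b ⟧ + 1ℤ) none) (cong (λ b → ⟦ b ∨ true ⟧) (sym none))
    where
    none : anyBelow h N ≡ false
    none = anyBelow-none h N (λ j j<N → unique j<N hN)
  ... | false = trans (ℤₚ.+-identityʳ _) (cong ⟦_⟧ (sym (∨-identityʳ (anyBelow h N))))

δ-triSum : ∀ n → + δ n ≡ triSum one n
δ-triSum n = begin
  + δ n ≡⟨ if-⟦⟧ (anyBelow (triangular n) (suc n)) ⟩
  ⟦ anyBelow (triangular n) (suc n) ⟧       ≡⟨ anyBelow-Σℕ (triangular n) (triangular-unique n) (suc n) ⟨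
  Σℕ (suc n) (λ j → ⟦ triangular n j ⟧)     ≡⟨ Σℕ-cong (suc n) (λ j _ → trans (shift-one (tri j) n) (cong ⟦_⟧ (triangular≡ n j))) ⟨
  triSum one n ∎
  where
  if-⟦⟧ : ∀ b → + (if b then 1 else 0) ≡ ⟦ b ⟧
  if-⟦⟧ true  = refl
  if-⟦⟧ false = refl

-- The convention that `σmex` and `M` vanish at negative arguments is the zero padding performed by
-- `shift`.
extend-shift : ∀ (f : ℤ → ℤ) → (∀ m → f -[1+ m ] ≡ 0ℤ) → ∀ n a → f (+ n - + a) ≡ shift a (λ m → f (+ m)) n
extend-shift f neg n a = trans (cong f (ℤₚ.m-n≡m⊖n n a)) (⊖-shift n a)
  where
  ⊖-shift : ∀ n a → f (n ℤ.⊖ a) ≡ shift a (λ m → f (+ m)) n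
  ⊖-shift n       zero    = refl
  ⊖-shift zero    (suc a) = neg a
  ⊖-shift (suc n) (suc a) = trans (cong f (ℤₚ.[1+m]⊖[1+n]≡m⊖n n a)) (⊖-shift n a)

σ-shift : ∀ n a → σmex (+ n - + a) ≡ shift a (triSum partitionSeq) n
σ-shift n a = trans (extend-shift σmex (λ _ → refl) n a) (shift-cong a σmexℕ-triSum n)

triSum-𝓜-suc : ∀ k n → triSum (𝓜 k) n + triSum (𝓜 (suc k)) n + shift (ω k ℕ.+ suc (k ℕ.+ k)) (triSum partitionSeq) n ≡ shift (ω k) (triSum partitionSeq) n
triSum-𝓜-suc k n = begin
  triSum (𝓜 k) n + triSum (𝓜 (suc k)) n + shift b (triSum partitionSeq) n
    ≡⟨ cong₂ _+_ (triSum-⊕ (𝓜 k) (𝓜 (suc k)) n) (triSum-shift b partitionSeq n) ⟨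
  triSum (𝓜 k ⊕ 𝓜 (suc k)) n + triSum (shift b partitionSeq) n       ≡⟨ triSum-⊕ (𝓜 k ⊕ 𝓜 (suc k)) (shift b partitionSeq) n ⟨
  triSum (𝓜 k ⊕ 𝓜 (suc k) ⊕ shift b partitionSeq) n             ≡⟨ triSum-cong (𝓜-suc k) n ⟩
  triSum (shift (ω k) partitionSeq) n                            ≡⟨ triSum-shift (ω k) partitionSeq n ⟩
  shift (ω k) (triSum partitionSeq) n ∎
  where
  b : ℕ
  b = ω k ℕ.+ suc (k ℕ.+ k)

-- Pentagonal exponents and signs

ω*2 : ∀ k → ω k * 2 ≡ k * (3 * k ℕ.+ 1)
ω*2 zero    = refl
ω*2 (suc c) = begin
  (tri c ℕ.+ suc c * suc (suc c)) * 2         ≡⟨ ℕₚ.*-distribʳ-+ 2 (tri c) (suc c * suc (suc c)) ⟩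
  tri c * 2 ℕ.+ suc c * suc (suc c) * 2       ≡⟨ cong (ℕ._+ suc c * suc (suc c) * 2) (tri*2 c) ⟩
  c * suc c ℕ.+ suc c * suc (suc c) * 2       ≡⟨ rearrange c ⟩
  suc c * (3 * suc c ℕ.+ 1) ∎
  where
  rearrange : ∀ c → c * suc c ℕ.+ suc c * suc (suc c) * 2 ≡ suc c * (3 * suc c ℕ.+ 1)
  rearrange = ℕ-Ring.solve-∀

-- Knowing the double makes the halving in `pent` exact, so that only polynomial identities remain.
pent-half : ∀ j x → j ℤ.* (+ 3 ℤ.* j - + 1) ≡ + (x * 2) → pent j ≡ + x
pent-half j x eq = cong +_ (trans (cong (λ y → ℤ.∣ y ∣ / 2) eq) (m*n/n≡m x 2))

+ω*2 : ∀ k → + (ω k * 2) ≡ + k ℤ.* (+ 3 ℤ.* + k + + 1)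
+ω*2 k = begin
  + (ω k * 2)                  ≡⟨ cong +_ (ω*2 k) ⟩
  + (k * (3 * k ℕ.+ 1))        ≡⟨ ℤₚ.pos-* k (3 * k ℕ.+ 1) ⟩
  + k ℤ.* + (3 * k ℕ.+ 1)      ≡⟨ cong (λ x → + k ℤ.* (x + + 1)) (ℤₚ.pos-* 3 k) ⟩
  + k ℤ.* (+ 3 ℤ.* + k + + 1) ∎

pent-neg : ∀ k → pent (- + k) ≡ + ω k
pent-neg k = pent-half (- + k) (ω k) (trans (rearrange (+ k)) (sym (+ω*2 k)))
  where
  rearrange : ∀ x → (- x) ℤ.* (+ 3 ℤ.* (- x) - + 1) ≡ x ℤ.* (+ 3 ℤ.* x + + 1)
  rearrange = solve-∀

pent-pos : ∀ k → pent (+ suc k) ≡ + (ω k ℕ.+ suc (k ℕ.+ k))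
pent-pos k = pent-half (+ suc k) (ω k ℕ.+ suc (k ℕ.+ k)) (begin
  + suc k ℤ.* (+ 3 ℤ.* + suc k - + 1)                 ≡⟨ rearrange (+ k) ⟩
  + k ℤ.* (+ 3 ℤ.* + k + + 1) + (+ 1 + (+ k + + k)) ℤ.* + 2
    ≡⟨ cong₂ _+_ (+ω*2 k) (ℤₚ.pos-* (suc (k ℕ.+ k)) 2) ⟨
  + (ω k * 2 ℕ.+ suc (k ℕ.+ k) * 2)                   ≡⟨ cong +_ (ℕₚ.*-distribʳ-+ 2 (ω k) (suc (k ℕ.+ k))) ⟨
  + ((ω k ℕ.+ suc (k ℕ.+ k)) * 2) ∎)
  where
  rearrange : ∀ x → (+ 1 + x) ℤ.* (+ 3 ℤ.* (+ 1 + x) - + 1)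
                  ≡ x ℤ.* (+ 3 ℤ.* x + + 1) + (+ 1 + (x + x)) ℤ.* + 2
  rearrange = solve-∀

sgn-suc : ∀ k → sgn (+ suc k) ≡ - sgn (+ k)
sgn-suc zero          = refl
sgn-suc (suc zero)    = refl
sgn-suc (suc (suc k)) = trans (sgn-+2 (suc k)) (trans (sgn-suc k) (cong -_ (sym (sgn-+2 k))))
  where
  sgn-+2 : ∀ k → sgn (+ suc (suc k)) ≡ sgn (+ k)
  sgn-+2 k = cong (λ r → if r ≡ᵇ 0 then + 1 else - (+ 1)) (trans (cong (ℕ._% 2) (ℕₚ.+-comm 2 k)) ([m+n]%n≡m%n k 2))

sgn-neg : ∀ k → sgn (- + k) ≡ sgn (+ k)
sgn-neg k = cong (λ a → if a ℕ.% 2 ≡ᵇ 0 then + 1 else - (+ 1)) (ℤₚ.∣-i∣≡∣i∣ (+ k))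

sgn² : ∀ j → sgn j ℤ.* sgn j ≡ 1ℤ
sgn² j with ℤ.∣ j ∣ ℕ.% 2 ≡ᵇ 0
... | true  = refl
... | false = refl

-- The alternating sum over a growing window

Σℤ-last : ∀ a l f → Σℤ a (suc l) f ≡ Σℤ a l f + f (a + + l)
Σℤ-last a zero    f = trans (ℤₚ.+-comm (f a) 0ℤ) (+-congˡ 0ℤ (cong f (sym (ℤₚ.+-identityʳ a))))
Σℤ-last a (suc l) f = begin
  f a + Σℤ (a + + 1) (suc l) f                        ≡⟨ +-congˡ (f a) (Σℤ-last (a + + 1) l f) ⟩
  f a + (Σℤ (a + + 1) l f + f (a + + 1 + + l))        ≡⟨ ℤₚ.+-assoc (f a) _ _ ⟨
  f a + Σℤ (a + + 1) l f + f (a + + 1 + + l)          ≡⟨ +-congˡ (f a + Σℤ (a + + 1) l f) (cong f (ℤₚ.+-assoc a (+ 1) (+ l))) ⟩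
  f a + Σℤ (a + + 1) l f + f (a + + suc l) ∎

-- The indices run from -(k - 1) to k. At `k = 0` there are none, which gives the induction its
-- starting point.
window : ℕ → (ℤ → ℤ) → ℤ
window k f = Σℤ (- (+ k - + 1)) (2 * k) f

window-suc : ∀ k f → window (suc k) f ≡ f (- + k) + (window k f + f (+ suc k))
window-suc k f = begin
  Σℤ (- + k) (2 * suc k) f                               ≡⟨ cong (λ l → Σℤ (- + k) l f) (length≡ k) ⟩
  f (- + k) + Σℤ (- + k + + 1) (suc (2 * k)) f           ≡⟨ +-congˡ (f (- + k)) (Σℤ-last (- + k + + 1) (2 * k) f) ⟩
  f (- + k) + (Σℤ (- + k + + 1) (2 * k) f + f (- + k + + 1 + + (2 * k)))
    ≡⟨ +-congˡ (f (- + k)) (cong₂ _+_ (cong (λ a → Σℤ a (2 * k) f) (start (+ k)))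
        (cong f (trans (cong (λ x → - + k + + 1 + x) (ℤₚ.pos-* 2 k)) (end (+ k))))) ⟩
  f (- + k) + (window k f + f (+ suc k)) ∎
  where
  length≡ : ∀ k → 2 * suc k ≡ suc (suc (2 * k))
  length≡ = ℕ-Ring.solve-∀

  start : ∀ x → - x + + 1 ≡ - (x - + 1)
  start = solve-∀

  end : ∀ x → - x + + 1 + + 2 ℤ.* x ≡ + 1 + x
  end = solve-∀

term : ℕ → ℤ → ℤ
term n j = sgn j ℤ.* σmex (+ n - pent j)

-- Passing from `k` to `k + 1` adds the indices -k and k + 1, with opposite signs and with exponents
-- ω(k) and ω(k) + 2k + 1. These are the two shifts in `triSum-𝓜-suc`, so the total does not change.
-- At `k = 0` it is `triSum one`.
window-𝓜 : ∀ n k → window k (term n) + sgn (+ k) ℤ.* triSum (𝓜 k) n ≡ + δ n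
window-𝓜 n zero    = trans (ℤₚ.+-identityˡ _) (trans (ℤₚ.*-identityˡ _) (sym (δ-triSum n)))
window-𝓜 n (suc k) = begin
  window (suc k) (term n) + sgn (+ suc k) ℤ.* W′
    ≡⟨ cong₂ _+_ (trans (window-suc k (term n)) (cong₂ (λ x y → x + (S + y)) neg-term pos-term))
                 (cong (ℤ._* W′) (sgn-suc k)) ⟩
  s ℤ.* A + (S + (- s) ℤ.* B) + (- s) ℤ.* W′
    ≡⟨ cong (λ x → s ℤ.* x + (S + (- s) ℤ.* B) + (- s) ℤ.* W′) (triSum-𝓜-suc k n) ⟨
  s ℤ.* (W + W′ + B) + (S + (- s) ℤ.* B) + (- s) ℤ.* W′
    ≡⟨ cancel s S W W′ B ⟩
  S + s ℤ.* W ≡⟨ window-𝓜 n k ⟩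
  + δ n ∎
  where
  s S W W′ A B : ℤ
  s = sgn (+ k)
  S = window k (term n)
  W = triSum (𝓜 k) n
  W′ = triSum (𝓜 (suc k)) n
  A = shift (ω k) (triSum partitionSeq) n
  B = shift (ω k ℕ.+ suc (k ℕ.+ k)) (triSum partitionSeq) n

  neg-term : term n (- + k) ≡ s ℤ.* A
  neg-term = cong₂ ℤ._*_ (sgn-neg k) (trans (cong (λ x → σmex (+ n - x)) (pent-neg k)) (σ-shift n (ω k)))

  pos-term : term n (+ suc k) ≡ (- s) ℤ.* B
  pos-term = cong₂ ℤ._*_ (sgn-suc k) (trans (cong (λ x → σmex (+ n - x)) (pent-pos k)) (σ-shift n (ω k ℕ.+ suc (k ℕ.+ k))))

  cancel : ∀ s S W W′ B → s ℤ.* (W + W′ + B) + (S + (- s) ℤ.* B) + (- s) ℤ.* W′ ≡ S + s ℤ.* W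
  cancel = solve-∀

theorem2 : (k : ℕ) → 1 ≤ k → (n : ℕ) →
    sgn (+ k - + 1) Data.Integer.* (Σℤ (- (+ k - + 1)) (2 * k) (λ j → sgn j Data.Integer.* σmex (+ n - pent j)) - + δ n)
    ≡ Σℕ (suc n) (λ j → M k (+ n - + ((j * suc j) / 2)))
theorem2 k@(suc c) _ n = begin
  -- Substituting for `δ n` cancels the window. What remains is W with sign -(-1)^k (-1)^{k-1}, that
  -- is, with the square of `s`.
  s ℤ.* (S - + δ n)                            ≡⟨ cong (λ x → s ℤ.* (S - x)) (window-𝓜 n k) ⟨
  s ℤ.* (S - (S + sgn (+ k) ℤ.* W))            ≡⟨ cong (λ x → s ℤ.* (S - (S + x ℤ.* W))) (sgn-suc c) ⟩
  s ℤ.* (S - (S + (- s) ℤ.* W))                ≡⟨ collect s S W ⟩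
  s ℤ.* s ℤ.* W                                ≡⟨ cong (ℤ._* W) (sgn² (+ c)) ⟩
  1ℤ ℤ.* W                                     ≡⟨ ℤₚ.*-identityˡ W ⟩
  W                                            ≡⟨ Σℕ-cong (suc n) (λ j _ → M-term j) ⟨
  Σℕ (suc n) (λ j → M k (+ n - + ((j * suc j) / 2))) ∎
  where
  s S W : ℤ
  s = sgn (+ c)
  S = window k (term n)
  W = triSum (𝓜 k) n

  M-term : ∀ j → M k (+ n - + ((j * suc j) / 2)) ≡ shift (tri j) (𝓜 k) n
  M-term j = trans (extend-shift (M k) (λ _ → refl) n ((j * suc j) / 2))
    (cong (λ a → shift a (𝓜 k) n) (trans (cong (_/ 2) (sym (tri*2 j))) (m*n/n≡m (tri j) 2)))

  collect : ∀ s S W → s ℤ.* (S - (S + (- s) ℤ.* W)) ≡ s ℤ.* s ℤ.* W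
  collect = solve-∀
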